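{- The derivability problem for the multiplicative fragment $\mathcal{M}^{\mathrm{mult}}_{2018}$ of Morrill's calculus with stoups defined below is algorithmically undecidable.
   Context: Formulae are built from a countable set of variables and the constant $\mathbf{1}$ by the binary connectives $\backslash$, $/$, $\cdot$ and the unary connectives $\langle\rangle$, $[]^{ -1}$ and $!$. A stoup is a finite multiset of formulae ($\varnothing$ empty). A tree term is a formula or $[\Xi]$ with $\Xi$ a meta-formula; a meta-formula is $\zeta;\Gamma$ with $\zeta$ a stoup and $\Gamma$ a finite linearly ordered sequence of tree terms (empty sequence $\Lambda$); $\varnothing;\Gamma$ is written $\Gamma$. Comma denotes concatenation of sequences and multiset union of stoups; $\zeta,A$ adds a copy of $A$. A sequent is $\Xi\to C$. $\Xi(\Theta)$ denotes a meta-formula with a designated occurrence of a meta-formula $\Theta$ which is $\Xi$ itself or the content of some bracket $[\Theta]$ at any depth; $\Xi(\Theta')$ is the result of replacement. The calculus $\mathcal{M}^{\mathrm{mult}}_{2018}$ has: axioms $A\to A$, $\Lambda\to\mathbf1$; ($/L$) from $\zeta_1;\Gamma\to B$ and $\Xi(\zeta_2;\Delta_1,C,\Delta_2)\to D$ infer $\Xi(\zeta_1,\zeta_2;\Delta_1,C/B,\Gamma,\Delta_2)\to D$; ($/R$) from $\zeta;\Gamma,B\to C$ infer $\zeta;\Gamma\to C/B$; ($\backslash L$) from $\zeta_1;\Gamma\to A$ and $\Xi(\zeta_2;\Delta_1,C,\Delta_2)\to D$ infer $\Xi(\zeta_1,\zeta_2;\Delta_1,\Gamma,A\backslash C,\Delta_2)\to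 D$; ($\backslash R$) from $\zeta;A,\Gamma\to C$ infer $\zeta;\Gamma\to A\backslash C$; ($\cdot L$) from $\Xi(\zeta;\Delta_1,A,B,\Delta_2)\to D$ infer $\Xi(\zeta;\Delta_1,A\cdot B,\Delta_2)\to D$; ($\cdot R$) from $\zeta_1;\Delta\to A$ and $\zeta_2;\Gamma\to B$ infer $\zeta_1,\zeta_2;\Delta,\Gamma\to A\cdot B$; ($\mathbf1L$) from $\Xi(\zeta;\Delta_1,\Delta_2)\to A$ infer $\Xi(\zeta;\Delta_1,\mathbf1,\Delta_2)\to A$; ($[]^{ -1}L$) from $\Xi(\zeta;\Delta_1,A,\Delta_2)\to B$ infer $\Xi(\zeta;\Delta_1,[[]^{ -1}A],\Delta_2)\to B$; ($[]^{ -1}R$) from $[\Xi]\to A$ infer $\Xi\to[]^{ -1}A$; ($\langle\rangle L$) from $\Xi(\zeta;\Delta_1,[A],\Delta_2)\to B$ infer $\Xi(\zeta;\Delta_1,\langle\rangle A,\Delta_2)\to B$; ($\langle\rangle R$) from $\Xi\to A$ infer $[\Xi]\to\langle\rangle A$; ($!L$) from $\Xi(\zeta,A;\Gamma_1,\Gamma_2)\to B$ infer $\Xi(\zeta;\Gamma_1,!A,\Gamma_2)\to B$; ($!P$) from $\Xi(\zeta;\Gamma_1,A,\Gamma_2)\to B$ infer $\Xi(\zeta,A;\Gamma_1,\Gamma_2)\to B$; ($!R$) from $!A\to B$ infer $!A\to!B$; ($!C$) from $\Xi(\zeta,A;\Gamma_1,[A;\Gamma_2],\Gamma_3)\to B$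 infer $\Xi(\zeta,A;\Gamma_1,[[\Gamma_2]],\Gamma_3)\to B$. Here $A,B,C,D$ are formulae, $\Gamma,\Delta,\Delta_i,\Gamma_i$ sequences of tree terms, $\zeta,\zeta_i$ stoups. Cut is not a rule. -}

module Defs where

open import Data.Fin using (Fin)
open import Data.List using (List; []; _∷_; _++_)
open import Data.List.Relation.Binary.Permutation.Propositional using (_↭_)
open import Data.Nat using (ℕ; zero; suc; _+_; _≤_; _<_; s≤s)
open import Data.Nat.Properties
open import Data.Product using (Σ; ∃; _×_; _,_; proj₁; proj₂)
open import Data.Vec using (Vec; lookup) renaming ([] to []ᵛ; _∷_ to _∷ᵛ_)
open import Function.Bundles using (_↣_; mk↣; Injection)
open import Relation.Binary.Definitions using (tri<; tri≈; tri>)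
open import Relation.Binary.PropositionalEquality
  using (_≡_; refl; sym; trans; cong; cong₂; subst)
open import Relation.Nullary using (¬_; contradiction)

------------------------------------------------------------------------
-- The calculus

infixr 8 _·_
infixr 7 _∖_
infixl 7 _/_
infix  9 ⟨⟩_ []⁻¹_ !_
infix  4 _⨾_
infix  3 _⇒_
infix  2 ⊢_

data Formula : Set where
  var           : ℕ → Formula
  𝟏             : Formula
  _∖_ _/_ _·_   : Formula → Formula → Formula
  ⟨⟩_ []⁻¹_ !_  : Formula → Formula

-- A stoup is a multiset; lists listing the same multiset are identified
-- by the rule `exch` of ⊢_ below.
Stoup : Set
Stoup = List Formula

mutual
  data TreeTerm : Set where
    fm  : Formula → TreeTerm
    ⟦_⟧ : Meta → TreeTerm

  data Meta : Set where
    _⨾_ : Stoup → List TreeTerm → Meta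

data Sequent : Set where
  _⇒_ : Meta → Formula → Sequent

-- Meta-formulae with one designated meta-formula, which is either the whole
-- or the content of some bracket.
data Context : Set where
  hole : Context
  into : Stoup → List TreeTerm → Context → List TreeTerm → Context

infix 6 _⟪_⟫

_⟪_⟫ : Context → Meta → Meta
hole           ⟪ Θ ⟫ = Θ
into ζ Γ Ξ Γ′ ⟪ Θ ⟫ = ζ ⨾ Γ ++ ⟦ Ξ ⟪ Θ ⟫ ⟧ ∷ Γ′

variable
  A B C D        : Formula
  ζ ζ₁ ζ₂        : Stoup
  Γ Γ₁ Γ₂ Γ₃     : List TreeTerm
  Δ Δ₁ Δ₂        : List TreeTerm
  Θ              : Meta

data ⊢_ : Sequent → Set where
  ax   : ⊢ [] ⨾ fm A ∷ [] ⇒ A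
  𝟏R   : ⊢ [] ⨾ [] ⇒ 𝟏

  /L   : ∀ Ξ → ⊢ ζ₁ ⨾ Γ ⇒ B
       → ⊢ Ξ ⟪ ζ₂ ⨾ Δ₁ ++ fm C ∷ Δ₂ ⟫ ⇒ D
       → ⊢ Ξ ⟪ ζ₁ ++ ζ₂ ⨾ Δ₁ ++ fm (C / B) ∷ Γ ++ Δ₂ ⟫ ⇒ D
  /R   : ⊢ ζ ⨾ Γ ++ fm B ∷ [] ⇒ C
       → ⊢ ζ ⨾ Γ ⇒ C / B

  ∖L   : ∀ Ξ → ⊢ ζ₁ ⨾ Γ ⇒ A
       → ⊢ Ξ ⟪ ζ₂ ⨾ Δ₁ ++ fm C ∷ Δ₂ ⟫ ⇒ D
       → ⊢ Ξ ⟪ ζ₁ ++ ζ₂ ⨾ Δ₁ ++ Γ ++ fm (A ∖ C) ∷ Δ₂ ⟫ ⇒ D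
  ∖R   : ⊢ ζ ⨾ fm A ∷ Γ ⇒ C
       → ⊢ ζ ⨾ Γ ⇒ A ∖ C

  ·L   : ∀ Ξ → ⊢ Ξ ⟪ ζ ⨾ Δ₁ ++ fm A ∷ fm B ∷ Δ₂ ⟫ ⇒ D
       → ⊢ Ξ ⟪ ζ ⨾ Δ₁ ++ fm (A · B) ∷ Δ₂ ⟫ ⇒ D
  ·R   : ⊢ ζ₁ ⨾ Δ ⇒ A
       → ⊢ ζ₂ ⨾ Γ ⇒ B
       → ⊢ ζ₁ ++ ζ₂ ⨾ Δ ++ Γ ⇒ A · B

  𝟏L   : ∀ Ξ → ⊢ Ξ ⟪ ζ ⨾ Δ₁ ++ Δ₂ ⟫ ⇒ A
       → ⊢ Ξ ⟪ ζ ⨾ Δ₁ ++ fm 𝟏 ∷ Δ₂ ⟫ ⇒ A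

  []⁻¹L : ∀ Ξ → ⊢ Ξ ⟪ ζ ⨾ Δ₁ ++ fm A ∷ Δ₂ ⟫ ⇒ B
        → ⊢ Ξ ⟪ ζ ⨾ Δ₁ ++ ⟦ [] ⨾ fm ([]⁻¹ A) ∷ [] ⟧ ∷ Δ₂ ⟫ ⇒ B
  []⁻¹R : ⊢ [] ⨾ ⟦ Θ ⟧ ∷ [] ⇒ A
        → ⊢ Θ ⇒ []⁻¹ A

  ⟨⟩L  : ∀ Ξ → ⊢ Ξ ⟪ ζ ⨾ Δ₁ ++ ⟦ [] ⨾ fm A ∷ [] ⟧ ∷ Δ₂ ⟫ ⇒ B
       → ⊢ Ξ ⟪ ζ ⨾ Δ₁ ++ fm (⟨⟩ A) ∷ Δ₂ ⟫ ⇒ B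
  ⟨⟩R  : ⊢ Θ ⇒ A
       → ⊢ [] ⨾ ⟦ Θ ⟧ ∷ [] ⇒ ⟨⟩ A

  !L   : ∀ Ξ → ⊢ Ξ ⟪ A ∷ ζ ⨾ Γ₁ ++ Γ₂ ⟫ ⇒ B
       → ⊢ Ξ ⟪ ζ ⨾ Γ₁ ++ fm (! A) ∷ Γ₂ ⟫ ⇒ B
  !P   : ∀ Ξ → ⊢ Ξ ⟪ ζ ⨾ Γ₁ ++ fm A ∷ Γ₂ ⟫ ⇒ B
       → ⊢ Ξ ⟪ A ∷ ζ ⨾ Γ₁ ++ Γ₂ ⟫ ⇒ B
  !R   : ⊢ [] ⨾ fm (! A) ∷ [] ⇒ B
       → ⊢ [] ⨾ fm (! A) ∷ [] ⇒ ! B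
  !C   : ∀ Ξ
       → ⊢ Ξ ⟪ A ∷ ζ ⨾ Γ₁ ++ ⟦ A ∷ [] ⨾ Γ₂ ⟧ ∷ Γ₃ ⟫ ⇒ B
       → ⊢ Ξ ⟪ A ∷ ζ ⨾ Γ₁ ++ ⟦ [] ⨾ ⟦ [] ⨾ Γ₂ ⟧ ∷ [] ⟧ ∷ Γ₃ ⟫ ⇒ B

  -- Not an inference of the calculus: premise and conclusion are the same
  -- sequent once stoups are read as multisets.
  exch : ∀ Ξ → ζ₁ ↭ ζ₂
       → ⊢ Ξ ⟪ ζ₁ ⨾ Γ ⟫ ⇒ A
       → ⊢ Ξ ⟪ ζ₂ ⨾ Γ ⟫ ⇒ A

------------------------------------------------------------------------
-- Algorithms: Kleene's partial recursive functions

data Rec : ℕ → Set where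
  zeroᶠ : Rec 0
  sucᶠ  : Rec 1
  proj  : ∀ {n} → Fin n → Rec n
  comp  : ∀ {m n} → Rec m → Vec (Rec n) m → Rec n
  prec  : ∀ {n} → Rec n → Rec (2 + n) → Rec (1 + n)
  μ     : ∀ {n} → Rec (1 + n) → Rec n

infix 4 _[_]⇓_

-- f [ xs ]⇓ y : the value of f at xs is defined and equals y.
data _[_]⇓_ : ∀ {n} → Rec n → Vec ℕ n → ℕ → Set where
  ⇓zero : zeroᶠ [ []ᵛ ]⇓ 0
  ⇓suc  : ∀ {x} → sucᶠ [ x ∷ᵛ []ᵛ ]⇓ suc x
  ⇓proj : ∀ {n} {i : Fin n} {xs} → proj i [ xs ]⇓ lookup xs i
  ⇓comp : ∀ {m n} {f : Rec m} {gs : Vec (Rec n) m} {xs ys z}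
        → (∀ i → lookup gs i [ xs ]⇓ lookup ys i)
        → f [ ys ]⇓ z
        → comp f gs [ xs ]⇓ z
  ⇓prec-zero : ∀ {n} {f : Rec n} {g xs y}
        → f [ xs ]⇓ y
        → prec f g [ 0 ∷ᵛ xs ]⇓ y
  ⇓prec-suc : ∀ {n} {f : Rec n} {g xs k r y}
        → prec f g [ k ∷ᵛ xs ]⇓ r
        → g [ k ∷ᵛ r ∷ᵛ xs ]⇓ y
        → prec f g [ suc k ∷ᵛ xs ]⇓ y
  ⇓μ    : ∀ {n} {f : Rec (1 + n)} {xs y}
        → (∀ i → i < y → ∃ λ k → f [ i ∷ᵛ xs ]⇓ suc k)
        → f [ y ∷ᵛ xs ]⇓ 0
        → μ f [ xs ]⇓ y

-- Some algorithm computes the characteristic function of P on codes.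
AlgorithmicallyDecidable : {X : Set} → X ↣ ℕ → (X → Set) → Set
AlgorithmicallyDecidable {X} numbering P =
  Σ (Rec 1) λ f → ∀ (x : X) →
      (P x   → f [ code x ∷ᵛ []ᵛ ]⇓ 1)
    × (¬ P x → f [ code x ∷ᵛ []ᵛ ]⇓ 0)
  where code = Injection.to numbering

------------------------------------------------------------------------
-- Gödel numbering of sequents

triangle : ℕ → ℕ
triangle zero    = 0
triangle (suc n) = suc n + triangle n

-- Cantor's pairing function.
pair : ℕ → ℕ → ℕ
pair a b = a + triangle (a + b)

mutual
  tagF : Formula → ℕ
  tagF (var _)  = 0
  tagF 𝟏        = 1
  tagF (_ ∖ _)  = 2
  tagF (_ / _)  = 3
  tagF (_ · _)  = 4
  tagF (⟨⟩ _)   = 5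
  tagF ([]⁻¹ _) = 6
  tagF (! _)    = 7

  bodyF : Formula → ℕ
  bodyF (var i)  = i
  bodyF 𝟏        = 0
  bodyF (A ∖ B)  = pair (codeF A) (codeF B)
  bodyF (A / B)  = pair (codeF A) (codeF B)
  bodyF (A · B)  = pair (codeF A) (codeF B)
  bodyF (⟨⟩ A)   = codeF A
  bodyF ([]⁻¹ A) = codeF A
  bodyF (! A)    = codeF A

  codeF : Formula → ℕ
  codeF A = pair (tagF A) (bodyF A)

codeStoup : Stoup → ℕ
codeStoup []      = 0
codeStoup (A ∷ ζ) = suc (pair (codeF A) (codeStoup ζ))

mutual
  codeT : TreeTerm → ℕ
  codeT (fm A)  = pair 0 (codeF A)
  codeT ⟦ Θ ⟧   = pair 1 (codeM Θ)

  codeSeq : List TreeTerm → ℕ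
  codeSeq []      = 0
  codeSeq (T ∷ Γ) = suc (pair (codeT T) (codeSeq Γ))

  codeM : Meta → ℕ
  codeM (ζ ⨾ Γ) = pair (codeStoup ζ) (codeSeq Γ)

codeSequent : Sequent → ℕ
codeSequent (Θ ⇒ A) = pair (codeM Θ) (codeF A)

triangle-mono : ∀ {m n} → m ≤ n → triangle m ≤ triangle n
triangle-mono {zero}          _         = _≤_.z≤n
triangle-mono {suc m} {suc n} (s≤s m≤n) =
  +-mono-≤ (s≤s m≤n) (triangle-mono m≤n)

pair-< : ∀ a b c d → a + b < c + d → pair a b < pair c d
pair-< a b c d lt = begin-strict
  a + triangle (a + b)             <⟨ s≤s (+-monoˡ-≤ _ (m≤m+n a b)) ⟩
  triangle (suc (a + b))           ≤⟨ triangle-mono lt ⟩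
  triangle (c + d)                 ≤⟨ m≤n+m _ c ⟩
  c + triangle (c + d)             ∎
  where open ≤-Reasoning

pair-injective : ∀ {a b c d} → pair a b ≡ pair c d → a ≡ c × b ≡ d
pair-injective {a} {b} {c} {d} eq with <-cmp (a + b) (c + d)
... | tri< lt _ _ = contradiction eq (<⇒≢ (pair-< a b c d lt))
... | tri> _ _ gt = contradiction (sym eq) (<⇒≢ (pair-< c d a b gt))
... | tri≈ _ s _  = a≡c , b≡d
  where
  a≡c : a ≡ c
  a≡c = +-cancelʳ-≡ (triangle (a + b)) a c
          (trans eq (cong (λ k → c + triangle k) (sym s)))
  b≡d : b ≡ d
  b≡d = +-cancelˡ-≡ a b d (trans s (cong (_+ d) (sym a≡c)))

mutual
  codeF-injective : ∀ {A B} → codeF A ≡ codeF B → A ≡ B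
  codeF-injective {A} {B} eq =
    let t , b = pair-injective {tagF A} {bodyF A} eq in tag-body-injective A B t b

  tag-body-injective : ∀ A B → tagF A ≡ tagF B → bodyF A ≡ bodyF B → A ≡ B
  tag-body-injective (var _)  (var _)  refl b = cong var b
  tag-body-injective 𝟏        𝟏        refl b = refl
  tag-body-injective (A ∖ A′) (B ∖ B′) refl b = binary-injective _∖_ A A′ B B′ b
  tag-body-injective (A / A′) (B / B′) refl b = binary-injective _/_ A A′ B B′ b
  tag-body-injective (A · A′) (B · B′) refl b = binary-injective _·_ A A′ B B′ b
  tag-body-injective (⟨⟩ A)   (⟨⟩ B)   refl b = cong ⟨⟩_ (codeF-injective b)
  tag-body-injective ([]⁻¹ A) ([]⁻¹ B) refl b = cong []⁻¹_ (codeF-injective b)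
  tag-body-injective (! A)    (! B)    refl b = cong !_ (codeF-injective b)

  binary-injective : (_∙_ : Formula → Formula → Formula) → ∀ A A′ B B′ →
    pair (codeF A) (codeF A′) ≡ pair (codeF B) (codeF B′) → A ∙ A′ ≡ B ∙ B′
  binary-injective _∙_ A A′ B B′ eq =
    let l , r = pair-injective {codeF A} eq
    in cong₂ _∙_ (codeF-injective l) (codeF-injective r)

codeStoup-injective : ∀ {ζ₁ ζ₂} → codeStoup ζ₁ ≡ codeStoup ζ₂ → ζ₁ ≡ ζ₂
codeStoup-injective {[]}    {[]}    _  = refl
codeStoup-injective {A ∷ _} {B ∷ _} eq =
  let h , t = pair-injective {codeF A} {c = codeF B} (suc-injective eq)
  in cong₂ _∷_ (codeF-injective h) (codeStoup-injective t)

mutual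
  codeT-injective : ∀ S T → codeT S ≡ codeT T → S ≡ T
  codeT-injective (fm A) (fm B) eq =
    cong fm (codeF-injective (proj₂ (pair-injective {0} {c = 0} eq)))
  codeT-injective ⟦ Θ ⟧ ⟦ Ξ ⟧ eq =
    cong ⟦_⟧ (codeM-injective Θ Ξ (proj₂ (pair-injective {1} {c = 1} eq)))
  codeT-injective (fm A) ⟦ Ξ ⟧ eq =
    contradiction (proj₁ (pair-injective {0} {codeF A} {1} {codeM Ξ} eq)) λ ()
  codeT-injective ⟦ Θ ⟧ (fm B) eq =
    contradiction (proj₁ (pair-injective {1} {codeM Θ} {0} {codeF B} eq)) λ ()

  codeSeq-injective : ∀ Γ Δ → codeSeq Γ ≡ codeSeq Δ → Γ ≡ Δ
  codeSeq-injective []      []      _  = refl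
  codeSeq-injective (S ∷ Γ) (T ∷ Δ) eq =
    let h , t = pair-injective {codeT S} {c = codeT T} (suc-injective eq)
    in cong₂ _∷_ (codeT-injective S T h) (codeSeq-injective Γ Δ t)

  codeM-injective : ∀ Θ Ξ → codeM Θ ≡ codeM Ξ → Θ ≡ Ξ
  codeM-injective (ζ₁ ⨾ Γ) (ζ₂ ⨾ Δ) eq =
    let s , t = pair-injective {codeStoup ζ₁} {c = codeStoup ζ₂} eq
    in cong₂ _⨾_ (codeStoup-injective s) (codeSeq-injective Γ Δ t)

codeSequent-injective : ∀ {S T} → codeSequent S ≡ codeSequent T → S ≡ T
codeSequent-injective {Θ ⇒ A} {Ξ ⇒ B} eq =
  let l , r = pair-injective {codeM Θ} {c = codeM Ξ} eq
  in cong₂ _⇒_ (codeM-injective Θ Ξ l) (codeF-injective r)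

-- A sequent has one code for each way of listing the members of its stoups.
gödel : Sequent ↣ ℕ
gödel = mk↣ codeSequent-injective

{-# OPTIONS --safe #-}

-- Given a decider d, run d on the query about the very machine doing this, and halt iff the answer
-- is no.  As d may be any recursive function, each Rec is compiled to a program over registers.
-- A program together with its registers is a word, and its steps are instances of finitely many
-- rules u w ↦ v w z, which pop a prefix u, push a prefix v and append a suffix z.
--
-- The rule u w ↦ v w z is the formula []⁻¹ (S / (u · (v ∖ (E ∖ (S / z))))) in the stoup.  The formula
-- E = ⟨⟩ ⟨⟩ 𝟏 at the left end of the sequence provides the double bracket that one contraction
-- consumes, []⁻¹ removes the single bracket left over, and the rule restores E; so a halting run is
-- a derivation read upwards.  Conversely, derivable sequents are valid when brackets are ignored,
-- formulae denote sets of words, ! A denotes the intersection of A with {ε}, and S denotes the words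
-- from which the machine halts.
module Submission where

open import Defs
open import Data.Fin using (Fin; zero; suc; _↑ˡ_; _↑ʳ_; #_)
open import Data.List using (List; []; _∷_; _++_; map; foldr; concatMap; filter; replicate)
open import Data.List.Membership.Propositional using (_∈_)
open import Data.List.Membership.Propositional.Properties
  using (∈-map⁺; ∈-∃++; ∈-++⁺ˡ; ∈-++⁺ʳ; ∈-++⁻; ∈-concatMap⁺; ∈-filter⁺)
open import Data.List.Properties using (++-assoc; ++-identityʳ; map-++)
open import Data.List.Relation.Binary.Permutation.Propositional using (↭-sym)
open import Data.List.Relation.Binary.Permutation.Propositional.Properties
  using (shift; All-resp-↭)
open import Data.List.Relation.Unary.All as All using (All; []; _∷_)
import Data.List.Relation.Unary.All.Properties as Allₚ
open import Data.List.Relation.Unary.Any as Any using (here; there)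
open import Data.Nat using (ℕ; zero; suc; _+_; _≟_; _<_; _≤_; s≤s)
open import Data.Nat.Properties
  using (+-assoc; +-comm; +-cancelˡ-≡; +-identityʳ; +-suc; ≤-refl; ≤-trans; n≤1+n; 1+n≰n;
         <⇒≢; m<n⇒m<1+n; m≤n+m)
open import Data.Product using (∃; ∃₂; _×_; _,_; proj₁; proj₂)
open import Data.Sum using (_⊎_; inj₁; inj₂)
open import Data.Unit using (⊤; tt)
open import Data.Vec as Vec using (Vec; []; _∷_; lookup; _[_]%=_; _[_]≔_)
  renaming (map to mapᵛ; _++_ to _++ᵛ_)
import Data.Vec.Properties as Vecₚ
open import Function using (_∘_)
open import Function.Bundles using (_⇔_; mk⇔; Equivalence)
open import Function.Construct.Composition using (_⇔-∘_)
open import Function.Construct.Identity using (⇔-id)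
open import Relation.Binary.PropositionalEquality
  using (_≡_; _≢_; _≗_; refl; sym; trans; cong; cong₂; subst)
open import Relation.Nullary using (¬_; ¬?; contradiction; yes; no)

-- Words and formulae

-- loop r p: while register r is positive, decrement it and run p.
data Instr : Set where
  inc  : ℕ → Instr
  loop : ℕ → List Instr → Instr

Code : Set
Code = List Instr

data Letter : Set where
  marker start : Letter
  reg          : ℕ → Letter
  lab mid      : Code → Letter

-- Instructions are written as formulae so that the injective `codeF` also numbers letters and gives
-- each letter a variable of its own.
mutual
  instrF : Instr → Formula
  instrF (inc r)    = var r
  instrF (loop r p) = var r · codeToF p

  codeToF : Code → Formula
  codeToF []      = 𝟏
  codeToF (i ∷ K) = instrF i · codeToF K

mutual
  instrF-injective : ∀ i j → instrF i ≡ instrF j → i ≡ j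
  instrF-injective (inc r)    (inc _)     refl = refl
  -- Once `codeToF p` is abstracted, unification can solve the equation; `e` remembers what was
  -- abstracted.
  instrF-injective (loop r p) (loop s q) eq with codeToF p in e | eq
  ... | _ | refl = cong (loop r) (codeToF-injective p q e)

  codeToF-injective : ∀ K L → codeToF K ≡ codeToF L → K ≡ L
  codeToF-injective []      []      _  = refl
  codeToF-injective (i ∷ K) (j ∷ L) eq with instrF i in e | codeToF K in e′ | eq
  ... | _ | _ | refl =
    cong₂ _∷_ (instrF-injective i j e) (codeToF-injective K L e′)

letterF : Letter → Formula
letterF marker  = ! 𝟏
letterF start   = ! (! 𝟏)
letterF (reg r) = var r
letterF (lab K) = ⟨⟩ codeToF K
letterF (mid K) = []⁻¹ codeToF K

⟨⟩-injective : ⟨⟩ A ≡ ⟨⟩ B → A ≡ B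
⟨⟩-injective refl = refl

[]⁻¹-injective : []⁻¹ A ≡ []⁻¹ B → A ≡ B
[]⁻¹-injective refl = refl

letterF-injective : ∀ x y → letterF x ≡ letterF y → x ≡ y
letterF-injective marker  marker  _    = refl
letterF-injective start   start   _    = refl
letterF-injective (reg r) (reg _) refl = refl
letterF-injective (lab K) (lab L) eq   = cong lab (codeToF-injective K L (⟨⟩-injective eq))
letterF-injective (mid K) (mid L) eq   = cong mid (codeToF-injective K L ([]⁻¹-injective eq))

letterF≢𝟏 : ∀ x → letterF x ≢ 𝟏
letterF≢𝟏 marker  ()
letterF≢𝟏 start   ()
letterF≢𝟏 (reg _) ()
letterF≢𝟏 (lab _) ()
letterF≢𝟏 (mid _) ()

-- Codes of variables are abstract because the numerals are too large to be normalised.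
abstract
  goalCode : ℕ
  goalCode = codeF 𝟏

  letterCode : Letter → ℕ
  letterCode x = codeF (letterF x)

  letterCode-injective : ∀ {x y} → letterCode x ≡ letterCode y → x ≡ y
  letterCode-injective eq = letterF-injective _ _ (codeF-injective eq)

  goalCode≢letterCode : ∀ x → goalCode ≢ letterCode x
  goalCode≢letterCode x eq = letterF≢𝟏 x (sym (codeF-injective {𝟏} eq))

S : Formula
S = var goalCode

atom : Letter → Formula
atom x = var (letterCode x)

Word : Set
Word = List Letter

letters : Word → List TreeTerm
letters = map (fm ∘ atom)

word : Word → Formula
word = foldr (λ x A → atom x · A) 𝟏

infix 4 _↦_∣_

record Rule : Set where
  constructor _↦_∣_
  field
    popped pushed appended : Word

open Rule

-- On the left of ⇒, E turns into ⟦ [] ⨾ ⟦ [] ⨾ [] ⟧ ∷ [] ⟧, the double bracket that !C consumes.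
E : Formula
E = ⟨⟩ ⟨⟩ 𝟏

stepF : Rule → Formula
stepF (u ↦ v ∣ z) = S / (word u · (word v ∖ (E ∖ (S / word z))))

ruleF : Rule → Formula
ruleF R = []⁻¹ (stepF R)

conj : Stoup → Formula
conj = foldr _·_ 𝟏

-- Banging twice lets a stoup copy of ! ruleF R prove the argument ! ruleF R of haltF,
-- which is how the unused rules are discarded in the end.
rulesF : List Rule → Stoup
rulesF = map (λ R → ! ruleF R)

-- This formula ends a run: its argument absorbs `E`, the final word and the rules left in the
-- stoup.
haltF : Word → List Rule → Formula
haltF h Rs = S / (E · (word h · conj (rulesF Rs)))

program : Word → List Rule → Stoup
program h Rs = haltF h Rs ∷ rulesF Rs

Derivable : Word → List Rule → Word → Set
Derivable h Rs w = ⊢ program h Rs ⨾ fm E ∷ letters w ⇒ S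

-- Derivations

cast : ∀ {Γ Γ′ ζ} → Γ ≡ Γ′ → ⊢ ζ ⨾ Γ ⇒ A → ⊢ ζ ⨾ Γ′ ⇒ A
cast refl d = d

castˢ : ∀ {ζ ζ′} → ζ ≡ ζ′ → ⊢ ζ ⨾ Γ ⇒ A → ⊢ ζ′ ⨾ Γ ⇒ A
castˢ refl d = d

word-right : ∀ u → ⊢ [] ⨾ letters u ⇒ word u
word-right []      = 𝟏R
word-right (x ∷ u) = ·R ax (word-right u)

word-left : ∀ u → ⊢ ζ ⨾ Δ₁ ++ letters u ++ Δ₂ ⇒ A → ⊢ ζ ⨾ Δ₁ ++ fm (word u) ∷ Δ₂ ⇒ A
word-left []      d = 𝟏L hole d
word-left {Δ₁ = Δ₁} {Δ₂} (x ∷ u) d =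
  ·L hole (cast (++-assoc Δ₁ _ _)
    (word-left {Δ₁ = Δ₁ ++ fm (atom x) ∷ []} u
      (cast (sym (++-assoc Δ₁ _ _)) d)))

conj-right : ∀ ζ → All (λ A → ⊢ A ∷ [] ⨾ [] ⇒ A) ζ → ⊢ ζ ⨾ [] ⇒ conj ζ
conj-right []      []       = 𝟏R
conj-right (A ∷ ζ) (d ∷ ds) = ·R d (conj-right ζ ds)

halt-derivable : ∀ h Rs → Derivable h Rs h
halt-derivable h Rs =
  !P {Γ₁ = []} hole
    (castˢ (++-identityʳ _)
      (cast (cong (fm (haltF h Rs) ∷_) (++-identityʳ _))
        (/L {Δ₁ = []} {Δ₂ = []} hole
          (·R ax (cast (++-identityʳ _) (·R (word-right h) (conj-right _
            (Allₚ.map⁺ (All.universal (λ _ → !P {Γ₁ = []} hole ax) Rs))))))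
          ax)))

-- Read upwards: `E` unfolds to an empty double bracket, `!C` replaces it by one bracket with a copy
-- of the stoup formula, `!P`, `!L`, `!P` release the copy and strip its bang, and `[]⁻¹L` trades
-- the bracket for `A`.
fetch : ! []⁻¹ A ∈ ζ → ⊢ ζ ⨾ fm A ∷ Γ ⇒ B → ⊢ ζ ⨾ fm E ∷ Γ ⇒ B
fetch {A = A} {Γ = Γ} i d with ∈-∃++ i
... | ζ₁ , ζ₂ , refl =
  ⟨⟩L {Δ₁ = []} hole
    (⟨⟩L {Δ₁ = []} (into ζ₀ [] hole Γ)
      (𝟏L {Δ₁ = []} (into ζ₀ [] (into [] [] hole []) Γ)
        (exch hole (↭-sym perm)
          (!C {Γ₁ = []} hole
            (!P {Γ₁ = []} (into _ [] hole Γ)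
              (!L {Γ₁ = []} (into _ [] hole Γ)
                (!P {Γ₁ = []} (into _ [] hole Γ)
                  ([]⁻¹L {Δ₁ = []} hole
                    (exch hole perm d)))))))))
  where
  ζ₀   = ζ₁ ++ (! []⁻¹ A) ∷ ζ₂
  perm = shift (! []⁻¹ A) ζ₁ ζ₂

step-derivable : ∀ {h Rs} R w → R ∈ Rs →
                 Derivable h Rs (pushed R ++ w ++ appended R) → Derivable h Rs (popped R ++ w)
step-derivable {h} {Rs} (u ↦ v ∣ z) w R∈Rs d =
  fetch (there (∈-map⁺ _ R∈Rs))
    (castˢ (++-identityʳ _)
      (cast (cong (fm _ ∷_) (trans (++-identityʳ _) (sym (map-++ _ u w))))
        (/L {Δ₁ = []} {Δ₂ = []} hole
          -- The popped letters prove `word u` with an empty stoup; the whole stoup and `w` go to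
          -- the other factor. Its introduction rules put `E` and `v` before `w` and `z` after it,
          -- ready for the next `fetch`.
          (·R (word-right u)
            (∖R (∖R (/R
              (word-left {Δ₁ = fm E ∷ []} v
                (cast (cong (fm E ∷_) (++-assoc (letters v) _ _))
                  (word-left {Δ₁ = fm E ∷ letters v ++ letters w} {Δ₂ = []} z
                    (cast (cong (fm E ∷_) reassoc) d))))))))
          ax)))
  where
  reassoc : letters (v ++ w ++ z) ≡ (letters v ++ letters w) ++ letters z ++ []
  reassoc = trans (map-++ _ v (w ++ z))
    (trans (cong (letters v ++_) (map-++ _ w z))
      (trans (sym (++-assoc (letters v) _ _))
        (cong ((letters v ++ letters w) ++_) (sym (++-identityʳ _)))))

-- A model

module Model (Accept : Word → Set) where

  ⟦_⟧ᶠ : Formula → Word → Set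
  ⟦ var n ⟧ᶠ w = (n ≡ goalCode × Accept w) ⊎ ∃ λ x → n ≡ letterCode x × w ≡ x ∷ []
  ⟦ 𝟏 ⟧ᶠ w     = w ≡ []
  ⟦ A ∖ C ⟧ᶠ w = ∀ u → ⟦ A ⟧ᶠ u → ⟦ C ⟧ᶠ (u ++ w)
  ⟦ C / B ⟧ᶠ w = ∀ u → ⟦ B ⟧ᶠ u → ⟦ C ⟧ᶠ (w ++ u)
  ⟦ A · B ⟧ᶠ w = ∃₂ λ u v → w ≡ u ++ v × ⟦ A ⟧ᶠ u × ⟦ B ⟧ᶠ v
  ⟦ ⟨⟩ A ⟧ᶠ    = ⟦ A ⟧ᶠ
  ⟦ []⁻¹ A ⟧ᶠ  = ⟦ A ⟧ᶠ
  ⟦ ! A ⟧ᶠ w   = w ≡ [] × ⟦ A ⟧ᶠ []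

  -- Members of a stoup are evaluated at the empty word only, so copying one, or placing it anywhere
  -- in a sequence, changes no word.
  ⟦_⟧ᶻ : Stoup → Set
  ⟦_⟧ᶻ = All (λ A → ⟦ A ⟧ᶠ [])

  mutual
    ⟦_⟧ᵗ : TreeTerm → Word → Set
    ⟦ fm A ⟧ᵗ  = ⟦ A ⟧ᶠ
    ⟦ ⟦ Θ ⟧ ⟧ᵗ = ⟦ Θ ⟧ᵐ

    ⟦_⟧ˢ : List TreeTerm → Word → Set
    ⟦ [] ⟧ˢ    w = w ≡ []
    ⟦ T ∷ Γ ⟧ˢ w = ∃₂ λ u v → w ≡ u ++ v × ⟦ T ⟧ᵗ u × ⟦ Γ ⟧ˢ v

    ⟦_⟧ᵐ : Meta → Word → Set
    ⟦ ζ ⨾ Γ ⟧ᵐ w = ⟦ ζ ⟧ᶻ × ⟦ Γ ⟧ˢ w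

  split : ∀ Γ {w} → ⟦ Γ ++ Δ ⟧ˢ w → ∃₂ λ u v → w ≡ u ++ v × ⟦ Γ ⟧ˢ u × ⟦ Δ ⟧ˢ v
  split []      p = [] , _ , refl , refl , p
  split (T ∷ Γ) (u , _ , refl , t , p) with split Γ p
  ... | v , v′ , refl , g , d = u ++ v , v′ , sym (++-assoc u v v′) , (u , v , refl , t , g) , d

  join : ∀ Γ {u v} → ⟦ Γ ⟧ˢ u → ⟦ Δ ⟧ˢ v → ⟦ Γ ++ Δ ⟧ˢ (u ++ v)
  join []      refl d = d
  join (T ∷ Γ) {v = v} (u , u′ , refl , t , g) d = u , u′ ++ v , ++-assoc u u′ v , t , join Γ g d

  _⊑_ : List TreeTerm → List TreeTerm → Set
  Γ ⊑ Γ′ = ∀ {w} → ⟦ Γ ⟧ˢ w → ⟦ Γ′ ⟧ˢ w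

  frame : ∀ Δ₁ → Γ₁ ⊑ Γ₂ → (Δ₁ ++ Γ₁) ⊑ (Δ₁ ++ Γ₂)
  frame Δ₁ f p with split Δ₁ p
  ... | _ , _ , refl , d , g = join Δ₁ d (f g)

  context : ∀ Ξ {Θ Θ′} → (∀ {w} → ⟦ Θ ⟧ᵐ w → ⟦ Θ′ ⟧ᵐ w) →
            ∀ {w} → ⟦ Ξ ⟪ Θ ⟫ ⟧ᵐ w → ⟦ Ξ ⟪ Θ′ ⟫ ⟧ᵐ w
  context hole            f p       = f p
  context (into ζ Γ Ξ Γ′) {Θ} {Θ′} f (z , p) =
    z , frame Γ (λ { (u , v , e , t , g) → u , v , e , context Ξ {Θ} {Θ′} f t , g }) p

  private
    single : ∀ T {w} → ⟦ T ⟧ᵗ w → ⟦ T ∷ [] ⟧ˢ w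
    single T {w} t = w , [] , sym (++-identityʳ w) , t , refl

    unsingle : ∀ T {w} → ⟦ T ∷ [] ⟧ˢ w → ⟦ T ⟧ᵗ w
    unsingle T (u , _ , refl , t , refl) = subst ⟦ T ⟧ᵗ (sym (++-identityʳ u)) t

  -- The denotation of an antecedent is monotone in each of its parts, so a left rule only needs a
  -- comparison at the place where it acts.
  sound : ⊢ Θ ⇒ A → ∀ {w} → ⟦ Θ ⟧ᵐ w → ⟦ A ⟧ᶠ w
  sound (ax {A}) (_ , p) = unsingle (fm A) p
  sound 𝟏R (_ , p) = p
  sound (/L {ζ₁} {Γ} {B} {ζ₂} {Δ₁} {C} {Δ₂} Ξ d e) p = sound e (context Ξ f p)
    where
    f : ∀ {w} → ⟦ ζ₁ ++ ζ₂ ⨾ Δ₁ ++ fm (C / B) ∷ Γ ++ Δ₂ ⟧ᵐ w → ⟦ ζ₂ ⨾ Δ₁ ++ fm C ∷ Δ₂ ⟧ᵐ w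
    f (z , q) = Allₚ.++⁻ʳ ζ₁ z , frame Δ₁ g q
      where
      g : (fm (C / B) ∷ Γ ++ Δ₂) ⊑ (fm C ∷ Δ₂)
      g (u , _ , refl , c , r) with split Γ r
      ... | v , v′ , refl , γ , δ =
        u ++ v , v′ , sym (++-assoc u v v′) , c v (sound d (Allₚ.++⁻ˡ ζ₁ z , γ)) , δ
  sound (/R {Γ = Γ} {B} d) (z , p) u b = sound d (z , join Γ p (single (fm B) b))
  sound (∖L {ζ₁} {Γ} {A} {ζ₂} {Δ₁} {C} {Δ₂} Ξ d e) p = sound e (context Ξ f p)
    where
    f : ∀ {w} → ⟦ ζ₁ ++ ζ₂ ⨾ Δ₁ ++ Γ ++ fm (A ∖ C) ∷ Δ₂ ⟧ᵐ w → ⟦ ζ₂ ⨾ Δ₁ ++ fm C ∷ Δ₂ ⟧ᵐ w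
    f (z , q) = Allₚ.++⁻ʳ ζ₁ z , frame Δ₁ g q
      where
      g : (Γ ++ fm (A ∖ C) ∷ Δ₂) ⊑ (fm C ∷ Δ₂)
      g r with split Γ r
      ... | u , _ , refl , γ , (v , v′ , refl , c , δ) =
        u ++ v , v′ , sym (++-assoc u v v′) , c u (sound d (Allₚ.++⁻ˡ ζ₁ z , γ)) , δ
  sound (∖R d) (z , p) u a = sound d (z , u , _ , refl , a , p)
  sound (·L {Δ₁ = Δ₁} {A} {B} {Δ₂} Ξ d) p =
    sound d (context Ξ (λ { (z , q) → z , frame Δ₁ g q }) p)
    where
    g : (fm (A · B) ∷ Δ₂) ⊑ (fm A ∷ fm B ∷ Δ₂)
    g (_ , w , refl , (u , v , refl , a , b) , γ) =
      u , v ++ w , ++-assoc u v w , a , v , w , refl , b , γ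
  sound (·R {ζ₁} {Δ} d e) (z , p) with split Δ p
  ... | u , v , refl , δ , γ =
    u , v , refl , sound d (Allₚ.++⁻ˡ ζ₁ z , δ) , sound e (Allₚ.++⁻ʳ ζ₁ z , γ)
  sound (𝟏L {Δ₁ = Δ₁} Ξ d) p =
    sound d (context Ξ (λ { (z , q) → z , frame Δ₁ (λ { (_ , _ , refl , refl , γ) → γ }) q }) p)
  sound ([]⁻¹L {Δ₁ = Δ₁} {A} Ξ d) p =
    sound d (context Ξ (λ { (z , q) → z ,
      frame Δ₁ (λ { (u , v , e , (_ , t) , γ) → u , v , e , unsingle (fm A) t , γ }) q }) p)
  sound ([]⁻¹R {Θ} d) p = sound d ([] , single ⟦ Θ ⟧ p)
  sound (⟨⟩L {Δ₁ = Δ₁} {A} Ξ d) p =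
    sound d (context Ξ (λ { (z , q) → z ,
      frame Δ₁ (λ { (u , v , e , t , γ) → u , v , e , ([] , single (fm A) t) , γ }) q }) p)
  sound (⟨⟩R {Θ} d) (_ , p) = sound d (unsingle ⟦ Θ ⟧ p)
  sound (!L {A} {ζ} {Γ₁} {Γ₂} Ξ d) p = sound d (context Ξ f p)
    where
    f : ∀ {w} → ⟦ ζ ⨾ Γ₁ ++ fm (! A) ∷ Γ₂ ⟧ᵐ w → ⟦ A ∷ ζ ⨾ Γ₁ ++ Γ₂ ⟧ᵐ w
    f (z , q) with split Γ₁ q
    ... | _ , _ , refl , γ₁ , (_ , _ , refl , (refl , a) , γ₂) = a ∷ z , join Γ₁ γ₁ γ₂
  sound (!P {Γ₁ = Γ₁} Ξ d) p =
    sound d (context Ξ (λ { (a ∷ z , q) → z , frame Γ₁ (λ γ → [] , _ , refl , a , γ) q }) p)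
  sound (!R {A} d) (z , p) with unsingle (fm (! A)) p
  ... | refl , _ = refl , sound d (z , p)
  sound (!C {A} {ζ} {Γ₁} {Γ₂} {Γ₃} Ξ d) p = sound d (context Ξ f p)
    where
    f : ∀ {w} → ⟦ A ∷ ζ ⨾ Γ₁ ++ ⟦ [] ⨾ ⟦ [] ⨾ Γ₂ ⟧ ∷ [] ⟧ ∷ Γ₃ ⟧ᵐ w →
                ⟦ A ∷ ζ ⨾ Γ₁ ++ ⟦ A ∷ [] ⨾ Γ₂ ⟧ ∷ Γ₃ ⟧ᵐ w
    f (a ∷ z , q) = a ∷ z , frame Γ₁ g q
      where
      g : (⟦ [] ⨾ ⟦ [] ⨾ Γ₂ ⟧ ∷ [] ⟧ ∷ Γ₃) ⊑ (⟦ A ∷ [] ⨾ Γ₂ ⟧ ∷ Γ₃)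
      g (u , v , e , (_ , t) , γ) = u , v , e , (a ∷ [] , proj₂ (unsingle ⟦ [] ⨾ Γ₂ ⟧ t)) , γ
  sound (exch Ξ perm d) p =
    sound d (context Ξ (λ { (z , q) → All-resp-↭ (↭-sym perm) z , q }) p)

  word-sound : ∀ u {w} → ⟦ word u ⟧ᶠ w → w ≡ u
  word-sound []      e = e
  word-sound (x ∷ u) (_ , v , refl , inj₁ (e , _) , q) =
    contradiction (sym e) (goalCode≢letterCode x)
  word-sound (x ∷ u) (_ , v , refl , inj₂ (y , e , refl) , q) =
    cong₂ _∷_ (sym (letterCode-injective e)) (word-sound u q)

  letters-complete : ∀ u → ⟦ letters u ⟧ˢ u
  letters-complete []      = refl
  letters-complete (x ∷ u) = x ∷ [] , u , refl , inj₂ (x , refl , refl) , letters-complete u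

  S-sound : ∀ {w} → ⟦ S ⟧ᶠ w → Accept w
  S-sound (inj₁ (_ , a))     = a
  S-sound (inj₂ (x , e , _)) = contradiction e (goalCode≢letterCode x)

  S-complete : ∀ {w} → Accept w → ⟦ S ⟧ᶠ w
  S-complete a = inj₁ (refl , a)

  word-complete : ∀ u → ⟦ word u ⟧ᶠ u
  word-complete []      = refl
  word-complete (x ∷ u) = x ∷ [] , u , refl , inj₂ (x , refl , refl) , word-complete u

  Closed : Rule → Set
  Closed (u ↦ v ∣ z) = ∀ w → Accept (v ++ w ++ z) → Accept (u ++ w)

  ruleF-valid : ∀ R → Closed R → ⟦ ruleF R ⟧ᶠ []
  ruleF-valid (u ↦ v ∣ z) closed _ (u′ , w , refl , p , k) with word-sound u p
  ... | refl = S-complete (closed w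
    (S-sound (subst ⟦ S ⟧ᶠ (++-assoc v w z)
      -- The three arguments of `k` are `v`, the empty word for `E`, and `z`.
      (k v (word-complete v) [] refl z (word-complete z)))))

  conj-sound : ∀ Rs {w} → ⟦ conj (rulesF Rs) ⟧ᶠ w → w ≡ []
  conj-sound []       e = e
  conj-sound (R ∷ Rs) (_ , _ , refl , (refl , _) , p) = conj-sound Rs p

  haltF-valid : ∀ h Rs → Accept h → ⟦ haltF h Rs ⟧ᶠ []
  haltF-valid h Rs a _ (_ , _ , refl , refl , u , v , refl , p , q)
    with word-sound h p | conj-sound Rs q
  ... | refl | refl = S-complete (subst Accept (sym (++-identityʳ h)) a)

  derivable-sound : ∀ h Rs {w} → Accept h → All Closed Rs → Derivable h Rs w → Accept w
  derivable-sound h Rs {w} a closed d =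
    S-sound (sound d
      ( haltF-valid h Rs a ∷ Allₚ.map⁺ (All.map (λ {R} c → refl , ruleF-valid R c) closed)
      , [] , w , refl , refl , letters-complete w))

-- Register machines

Store : Set
Store = ℕ → ℕ

δ : ℕ → ℕ → ℕ
δ r j with r ≟ j
... | yes _ = 1
... | no  _ = 0

δ-refl : ∀ r → δ r r ≡ 1
δ-refl r with r ≟ r
... | yes _  = refl
... | no r≢r = contradiction refl r≢r

δ-≢ : ∀ {r j} → r ≢ j → δ r j ≡ 0
δ-≢ {r} {j} r≢j with r ≟ j
... | yes e = contradiction e r≢j
... | no _  = refl

bump : ℕ → Store → Store
bump r σ j = δ r j + σ j

bump-cong : ∀ r {σ τ} → σ ≗ τ → bump r σ ≗ bump r τ
bump-cong r e j = cong (δ r j +_) (e j)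

bump-injective : ∀ r {σ τ} → bump r σ ≗ bump r τ → σ ≗ τ
bump-injective r e j = +-cancelˡ-≡ (δ r j) _ _ (e j)

bump-≢0 : ∀ r {σ τ} → σ ≗ bump r τ → σ r ≢ 0
bump-≢0 r {τ = τ} e z with trans (cong (_+ τ r) (sym (δ-refl r))) (trans (sym (e r)) z)
... | ()

-- A run must end with an empty store because `haltF` is used with one final word, which has no
-- register letters. Decrementing is stated backwards, through a store `τ` whose bump is `σ`.
data Halts : Code → Store → Set where
  done  : ∀ {σ} → (∀ j → σ j ≡ 0) → Halts [] σ
  inc   : ∀ {r K σ} → Halts K (bump r σ) → Halts (inc r ∷ K) σ
  loop₀ : ∀ {r p K σ} → σ r ≡ 0 → Halts K σ → Halts (loop r p ∷ K) σ
  loop₊ : ∀ {r p K σ τ} → σ ≗ bump r τ → Halts (p ++ loop r p ∷ K) τ → Halts (loop r p ∷ K) σ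

Halts-resp : ∀ {K σ τ} → σ ≗ τ → Halts K σ → Halts K τ
Halts-resp e (done z)    = done (λ j → trans (sym (e j)) (z j))
Halts-resp e (inc h)     = inc (Halts-resp (bump-cong _ e) h)
Halts-resp e (loop₀ z h) = loop₀ (trans (sym (e _)) z) (Halts-resp e h)
Halts-resp e (loop₊ b h) = loop₊ (λ j → trans (sym (e j)) (b j)) h

count : List ℕ → Store
count []      j = 0
count (r ∷ w) j = bump r (count w) j

count-++ : ∀ u v j → count (u ++ v) j ≡ count u j + count v j
count-++ []      v j = refl
count-++ (r ∷ u) v j = trans (cong (δ r j +_) (count-++ u v j)) (sym (+-assoc (δ r j) _ _))

count-comm : ∀ u v → count (u ++ v) ≗ count (v ++ u)
count-comm u v j =
  trans (count-++ u v j) (trans (+-comm (count u j) _) (sym (count-++ v u j)))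

-- The split is at the first `r`, because the scan for `r` can rotate only other letters.
count-split : ∀ r w → count w r ≢ 0 → ∃₂ λ u v → w ≡ u ++ r ∷ v × All (_≢ r) u
count-split r []      nz = contradiction refl nz
count-split r (x ∷ w) nz with x ≟ r
... | yes refl = [] , w , refl , []
... | no  x≢r with count-split r w nz
...   | u , v , refl , ne = x ∷ u , v , refl , x≢r ∷ ne

count-≡0 : ∀ r w → count w r ≡ 0 → All (_≢ r) w
count-≡0 r []      _ = []
count-≡0 r (x ∷ w) z with x ≟ r
... | no x≢r = x≢r ∷ count-≡0 r w z

-- The continuations reachable from p ++ L before L itself runs.
codes : Code → Code → List Code
codes []             L = L ∷ []
codes (inc r ∷ p)    L = (inc r ∷ p ++ L) ∷ codes p L
codes (loop r q ∷ p) L = (loop r q ∷ p ++ L) ∷ codes q (loop r q ∷ p ++ L) ++ codes p L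

successors : Code → List Code
successors []             = []
successors (inc r ∷ K)    = K ∷ []
successors (loop r q ∷ K) = K ∷ (q ++ loop r q ∷ K) ∷ []

first∈codes : ∀ p {L} → p ++ L ∈ codes p L
first∈codes []             = here refl
first∈codes (inc r ∷ p)    = here refl
first∈codes (loop r q ∷ p) = here refl

-- `L` is the only way out of the list: the end of a loop body `q` is the loop itself, which heads
-- the list.
codes-closed : ∀ p {L K} → K ∈ codes p L →
               K ≡ L ⊎ (∀ {K′} → K′ ∈ successors K → K′ ∈ codes p L)
codes-closed []             (here e)     = inj₁ e
codes-closed (inc r ∷ p)    (here refl)  = inj₂ λ { (here refl) → there (first∈codes p) }
codes-closed (inc r ∷ p)    (there i) with codes-closed p i
... | inj₁ e = inj₁ e
... | inj₂ s = inj₂ (there ∘ s)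
codes-closed (loop r q ∷ p) {L} (here refl) = inj₂ λ
  { (here refl)         → there (∈-++⁺ʳ (codes q _) (first∈codes p))
  ; (there (here refl)) → there (∈-++⁺ˡ (first∈codes q)) }
codes-closed (loop r q ∷ p) {L} (there i) with ∈-++⁻ (codes q (loop r q ∷ p ++ L)) i
... | inj₂ j with codes-closed p j
...   | inj₁ e = inj₁ e
...   | inj₂ s = inj₂ (there ∘ ∈-++⁺ʳ (codes q _) ∘ s)
codes-closed (loop r q ∷ p) {L} (there i) | inj₁ j with codes-closed q j
...   | inj₁ refl = codes-closed (loop r q ∷ p) (here refl)
...   | inj₂ s = inj₂ (there ∘ ∈-++⁺ˡ ∘ s)

rotate : Letter → ℕ → Rule
rotate l x = l ∷ reg x ∷ [] ↦ l ∷ [] ∣ reg x ∷ []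

-- lab (loop r p ∷ K) scans the word for r, moving it letter by letter behind the marker;
-- once r is found and deleted, mid (loop r p ∷ K) moves the remaining letters.
instrRules : List ℕ → Code → List Rule
instrRules R []             = []
instrRules R (inc r ∷ K)    = (lab (inc r ∷ K) ∷ [] ↦ lab K ∷ reg r ∷ [] ∣ []) ∷ []
instrRules R (loop r p ∷ K) =
  (lab L ∷ marker ∷ []     ↦ lab K ∷ []        ∣ marker ∷ []) ∷
  (mid L ∷ marker ∷ []     ↦ lab (p ++ L) ∷ [] ∣ marker ∷ []) ∷
  (lab L ∷ reg r ∷ []      ↦ mid L ∷ []        ∣ []) ∷
  map (rotate (mid L)) R ++ map (rotate (lab L)) (filter (λ x → ¬? (x ≟ r)) R)
  where L = loop r p ∷ K

incremented : Code → List ℕ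
incremented (inc r ∷ _) = r ∷ []
incremented _           = []

-- The rewriting rules of a program

module Machine (K₀ : Code) where

  -- The input is written with register 0, and only `inc` creates further letters, so finitely many
  -- rotations suffice.
  registers : List ℕ
  registers = 0 ∷ concatMap incremented (codes K₀ [])

  -- The letter `start` does not mention `K₀`; the first rule supplies it. Hence the initial word
  -- depends on the input alone and the program enters a query only through the stoup.
  rules : List Rule
  rules = (start ∷ marker ∷ [] ↦ lab K₀ ∷ [] ∣ marker ∷ []) ∷
          concatMap (instrRules registers) (codes K₀ [])

  final : Word
  final = lab [] ∷ marker ∷ []

  data Config : Set where
    init  : List ℕ → Config
    at    : Code → List ℕ → List ℕ → Config
    found : Code → List ℕ → List ℕ → Config

  tape : List ℕ → List ℕ → Word
  tape v u = map reg v ++ marker ∷ map reg u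

  config : Config → Word
  config (init v)      = start ∷ tape [] v
  config (at K v u)    = lab K ∷ tape v u
  config (found K v u) = mid K ∷ tape v u

  -- What the letters u behind the marker are known to be while K is being executed.
  Scanned : Code → List ℕ → Set
  Scanned []             u = ⊤
  Scanned (inc r ∷ K)    u = u ≡ []
  Scanned (loop r p ∷ K) u = count u r ≡ 0

  Scanned-[] : ∀ K → Scanned K []
  Scanned-[] []             = tt
  Scanned-[] (inc r ∷ K)    = refl
  Scanned-[] (loop r p ∷ K) = refl

  -- Rules must be closed on words that no run produces too, such as a scan that has already passed
  -- an `r`; nothing is demanded there. In `found` the `r` is already erased, so the store is the
  -- decremented one.
  Good : Config → Set
  Good (init v)                   = Halts K₀ (count v)
  Good (at K v u)                 = Scanned K u → Halts K (count (v ++ u))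
  Good (found (loop r p ∷ K) v u) = Halts (p ++ loop r p ∷ K) (count (v ++ u))
  Good (found _ v u)              = ⊤

  -- Quantifying over all readings of w makes Closed a statement about one step from each config.
  Accept : Word → Set
  Accept w = ∀ c → w ≡ config c → Good c

  open Model Accept

  -- Derivability implies halting

  tape-snoc : ∀ v u x → tape v u ++ reg x ∷ [] ≡ tape v (u ++ x ∷ [])
  tape-snoc v u x =
    trans (++-assoc (map reg v) _ _) (cong (λ z → map reg v ++ marker ∷ z) (sym (map-++ reg u _)))

  instrRules-closed : ∀ R K → All Closed (instrRules R K)
  instrRules-closed R []          = []
  instrRules-closed R (inc r ∷ K) = closed ∷ []
    where
    closed : Closed (lab (inc r ∷ K) ∷ [] ↦ lab K ∷ reg r ∷ [] ∣ [])
    closed _ a (at _ v []) refl refl =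
      inc (a (at K (r ∷ v) []) (cong (λ w → lab K ∷ reg r ∷ w) (++-identityʳ _)) (Scanned-[] K))
  instrRules-closed R (loop r p ∷ K) =
    exit ∷ enter ∷ erase ∷
    Allₚ.++⁺ (Allₚ.map⁺ (All.universal rotate-mid R))
             (Allₚ.map⁺ (All.map (λ {x} → rotate-lab x) (Allₚ.all-filter (λ x → ¬? (x ≟ r)) R)))
    where
    L = loop r p ∷ K

    exit : Closed (lab L ∷ marker ∷ [] ↦ lab K ∷ [] ∣ marker ∷ [])
    exit _ a (at _ [] u) refl z =
      loop₀ z (subst (Halts K ∘ count) (++-identityʳ u) (a (at K u []) refl (Scanned-[] K)))

    enter : Closed (mid L ∷ marker ∷ [] ↦ lab (p ++ L) ∷ [] ∣ marker ∷ [])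
    enter _ a (found _ [] u) refl =
      subst (Halts (p ++ L) ∘ count) (++-identityʳ u)
        (a (at (p ++ L) u []) refl (Scanned-[] (p ++ L)))

    erase : Closed (lab L ∷ reg r ∷ [] ↦ mid L ∷ [] ∣ [])
    erase _ a (at _ (_ ∷ v) u) refl _ =
      loop₊ (λ _ → refl) (a (found L v u) (cong (mid L ∷_) (++-identityʳ _)))

    snoc-count : ∀ x v u → count (v ++ u ++ x ∷ []) ≗ count (x ∷ v ++ u)
    snoc-count x v u j =
      trans (cong (λ w → count w j) (sym (++-assoc v u _))) (count-comm (v ++ u) (x ∷ []) j)

    rotate-mid : ∀ x → Closed (rotate (mid L) x)
    rotate-mid x _ a (found _ (_ ∷ v) u) refl =
      Halts-resp (snoc-count x v u)
        (a (found L v (u ++ x ∷ [])) (cong (mid L ∷_) (tape-snoc v u x)))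

    rotate-lab : ∀ x → x ≢ r → Closed (rotate (lab L) x)
    rotate-lab x x≢r _ a (at _ (_ ∷ v) u) refl z =
      Halts-resp (snoc-count x v u)
        (a (at L v (u ++ x ∷ [])) (cong (lab L ∷_) (tape-snoc v u x))
          -- Since `x` differs from `r`, there is still no `r` behind the marker.
          (trans (count-comm u (x ∷ []) r) (cong₂ _+_ (δ-≢ x≢r) z)))

  rules-closed : All Closed rules
  rules-closed = begin ∷
    Allₚ.concat⁺ (Allₚ.map⁺ (All.universal (instrRules-closed registers) (codes K₀ [])))
    where
    begin : Closed (start ∷ marker ∷ [] ↦ lab K₀ ∷ [] ∣ marker ∷ [])
    begin _ a (init v) refl =
      subst (Halts K₀ ∘ count) (++-identityʳ v) (a (at K₀ v []) refl (Scanned-[] K₀))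

  final-accepted : Accept final
  final-accepted (at _ [] []) refl _ = done (λ _ → refl)

  derivable⇒halts : ∀ v → Derivable final rules (config (init v)) → Halts K₀ (count v)
  derivable⇒halts v d = derivable-sound final rules final-accepted rules-closed d (init v) refl

  -- Halting implies derivability

  Derivable′ : Word → Set
  Derivable′ = Derivable final rules

  apply-rule : ∀ R w → R ∈ rules →
               Derivable′ (pushed R ++ w ++ appended R) → Derivable′ (popped R ++ w)
  apply-rule = step-derivable {final} {rules}

  instrRule : ∀ {R K} → K ∈ codes K₀ [] → R ∈ instrRules registers K → R ∈ rules
  instrRule i j = there (∈-concatMap⁺ (instrRules registers) (Any.map (λ { refl → j }) i))

  rotate-lab∈ : ∀ {r p K u} → loop r p ∷ K ∈ codes K₀ [] → All (_∈ registers) u → All (_≢ r) u →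
                All (λ x → rotate (lab (loop r p ∷ K)) x ∈ rules) u
  rotate-lab∈ {r} {p} {K} i js ≢r = All.zipWith (λ (j , x≢r) → instrRule i (there (there (there
    (∈-++⁺ʳ (map (rotate (mid L)) registers)
      (∈-map⁺ (rotate (lab L)) (∈-filter⁺ (λ x → ¬? (x ≟ r)) j x≢r))))))) (js , ≢r)
    where L = loop r p ∷ K

  rotate-mid∈ : ∀ {r p K u} → loop r p ∷ K ∈ codes K₀ [] → All (_∈ registers) u →
                All (λ x → rotate (mid (loop r p ∷ K)) x ∈ rules) u
  rotate-mid∈ i = All.map (λ j → instrRule i (there (there (there (∈-++⁺ˡ (∈-map⁺ (rotate (mid _)) j))))))

  -- Each rotation appends its letter at the far end, hence the generalisation over the `u` already
  -- behind the marker.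
  rotate-all : ∀ l v {u w} → All (λ x → rotate l x ∈ rules) v →
               Derivable′ (l ∷ w ++ marker ∷ map reg (u ++ v)) →
               Derivable′ (l ∷ map reg v ++ w ++ marker ∷ map reg u)
  rotate-all l []      {u} {w} []       d =
    subst (λ z → Derivable′ (l ∷ w ++ marker ∷ map reg z)) (++-identityʳ u) d
  rotate-all l (x ∷ v) {u} {w} (i ∷ is) d =
    apply-rule (rotate l x) (map reg v ++ w ++ marker ∷ map reg u) i
      (subst Derivable′ (cong (l ∷_) shape)
        (rotate-all l v {u ++ x ∷ []} {w} is
          (subst (λ z → Derivable′ (l ∷ w ++ marker ∷ map reg z)) (sym (++-assoc u _ v)) d)))
    where
    shape : map reg v ++ w ++ marker ∷ map reg (u ++ x ∷ []) ≡
            (map reg v ++ w ++ marker ∷ map reg u) ++ reg x ∷ []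
    shape = sym (trans (++-assoc (map reg v) _ _) (cong (map reg v ++_)
      (trans (++-assoc w _ _) (cong (λ z → w ++ marker ∷ z) (sym (map-++ reg u _))))))

  -- Induction on the run. A pass through the word may permute its letters, so `w` is tied to the
  -- store by its counts alone; at the end of each pass the marker is last again.
  halts⇒derivable : ∀ {K σ} → Halts K σ → K ∈ codes K₀ [] → ∀ w → count w ≗ σ →
                    All (_∈ registers) w → Derivable′ (config (at K w []))
  halts⇒derivable (done z) i [] _ _ = halt-derivable final rules
  halts⇒derivable (done z) i (x ∷ w) e _ =
    contradiction (trans (e x) (z x)) (bump-≢0 x {τ = count w} (λ _ → refl))
  halts⇒derivable (inc {r} {K} h) i w e b with codes-closed K₀ i
  ... | inj₂ s =
    apply-rule (lab (inc r ∷ K) ∷ [] ↦ lab K ∷ reg r ∷ [] ∣ []) (tape w []) (instrRule i (here refl))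
      (subst Derivable′ (cong (λ z → lab K ∷ reg r ∷ z) (sym (++-identityʳ _)))
        (halts⇒derivable h (s (here refl)) (r ∷ w) (bump-cong r e)
          (there (∈-concatMap⁺ incremented (Any.map (λ { refl → here refl }) i)) ∷ b)))
  halts⇒derivable (loop₀ {r} {p} {K} z h) i w e b with codes-closed K₀ i
  ... | inj₂ s =
    rotate-all (lab L) w {[]} {[]}
      (rotate-lab∈ i b (count-≡0 r w (trans (e r) z)))
      (apply-rule (lab L ∷ marker ∷ [] ↦ lab K ∷ [] ∣ marker ∷ []) (map reg w) (instrRule i (here refl))
        (halts⇒derivable h (s (here refl)) w e b))
    where L = loop r p ∷ K
  halts⇒derivable (loop₊ {r} {p} {K} {τ = τ} eq h) i w e b with codes-closed K₀ i
  ... | inj₂ s with count-split r w (λ z → bump-≢0 r {τ = τ} eq (trans (sym (e r)) z))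
  ...   | u , v , refl , u≢r with Allₚ.++⁻ u b
  ...     | bu , _ ∷ bv =
    -- From the outside in: rotate `u`, erase `r`, rotate `v`, and enter the body while the marker
    -- returns to the end.
    subst (λ z → Derivable′ (lab L ∷ z))
      (trans (sym (++-assoc (map reg u) _ _)) (cong (_++ marker ∷ []) (sym (map-++ reg u (r ∷ v)))))
      (rotate-all (lab L) u {[]} {map reg (r ∷ v)}
        (rotate-lab∈ i bu u≢r)
        (apply-rule (lab L ∷ reg r ∷ [] ↦ mid L ∷ [] ∣ []) (tape v u)
          (instrRule i (there (there (here refl))))
          (subst (λ z → Derivable′ (mid L ∷ z)) (sym (++-identityʳ _))
            (rotate-all (mid L) v {u} {[]}
              (rotate-mid∈ i bv)
              (apply-rule (mid L ∷ marker ∷ [] ↦ lab (p ++ L) ∷ [] ∣ marker ∷ []) (map reg (u ++ v))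
                (instrRule i (there (here refl)))
                (halts⇒derivable h (s (there (here refl))) (u ++ v) count-uv (Allₚ.++⁺ bu bv)))))))
    where
    L = loop r p ∷ K
    count-uv : count (u ++ v) ≗ τ
    count-uv = bump-injective r (λ j → trans (cong (δ r j +_) (count-comm u v j))
      (trans (count-comm (r ∷ v) u j) (trans (e j) (eq j))))

  halts⇒derivable-init : ∀ m → Halts K₀ (count (replicate m 0)) →
                         Derivable′ (config (init (replicate m 0)))
  halts⇒derivable-init m h =
    apply-rule (start ∷ marker ∷ [] ↦ lab K₀ ∷ [] ∣ marker ∷ []) (map reg (replicate m 0))
      (here refl)
      (halts⇒derivable h (subst (_∈ codes K₀ []) (++-identityʳ K₀) (first∈codes K₀))
        (replicate m 0) (λ _ → refl) (Allₚ.replicate⁺ m (here refl)))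

-- Compiling recursive functions

variable
  k m n x y z : ℕ
  p q         : Code
  σ σ′ σ″     : Vec ℕ k
  i o         : Fin k
  xs          : Vec ℕ n

-- Register names are de Bruijn levels, so allocating a register at the head of a
-- state does not rename the others.
level : Fin k → ℕ
level {suc k} zero    = k
level {suc k} (suc i) = level i

level< : (i : Fin k) → level i < k
level< zero    = ≤-refl
level< (suc i) = m<n⇒m<1+n (level< i)

store : Vec ℕ k → Store
store []                j = 0
store {suc k} (x ∷ σ) j with k ≟ j
... | yes _ = x
... | no  _ = store σ j

store-≥ : (σ : Vec ℕ k) → ∀ j → k ≤ j → store σ j ≡ 0
store-≥ []              j _  = refl
store-≥ {suc k} (x ∷ σ) j le with k ≟ j
... | yes refl = contradiction le 1+n≰n
... | no  _    = store-≥ σ j (≤-trans (n≤1+n k) le)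

store-level : (σ : Vec ℕ k) (i : Fin k) → store σ (level i) ≡ lookup σ i
store-level {suc k} (x ∷ σ) zero with k ≟ k
... | yes _  = refl
... | no k≢k = contradiction refl k≢k
store-level {suc k} (x ∷ σ) (suc i) with k ≟ level i
... | yes e = contradiction (sym e) (<⇒≢ (level< i))
... | no _  = store-level σ i

store-alloc : (σ : Vec ℕ k) → store (0 ∷ σ) ≗ store σ
store-alloc {k} σ j with k ≟ j
... | yes refl = sym (store-≥ σ k ≤-refl)
... | no _     = refl

store-suc : (σ : Vec ℕ k) (i : Fin k) → store (σ [ i ]%= suc) ≗ bump (level i) (store σ)
store-suc {suc k} (x ∷ σ) zero j with k ≟ j
... | yes _ = refl
... | no  _ = refl
store-suc {suc k} (x ∷ σ) (suc i) j with k ≟ j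
... | yes refl = cong (_+ x) (sym (δ-≢ (<⇒≢ (level< i))))
... | no _     = store-suc σ i j

-- An equivalence, since determinism is needed to refute halting.
record Eff (p : Code) (σ σ′ : Vec ℕ k) : Set where
  constructor eff
  field
    run : ∀ K → Halts (p ++ K) (store σ) ⇔ Halts K (store σ′)

open Eff

resp : ∀ {K σ τ} → σ ≗ τ → Halts K σ ⇔ Halts K τ
resp e = mk⇔ (Halts-resp e) (Halts-resp (sym ∘ e))

skipᴱ : Eff [] σ σ
skipᴱ = eff λ K → ⇔-id _

castᴱ : σ′ ≡ σ″ → Eff p σ σ′ → Eff p σ σ″
castᴱ refl f = f

infixr 5 _⨟_
_⨟_ : Eff p σ σ′ → Eff q σ′ σ″ → Eff (p ++ q) σ σ″
_⨟_ {p = p} {σ = σ} {q = q} f g = eff λ K →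
  subst (λ L → Halts L (store σ) ⇔ _) (sym (++-assoc p q K)) (run g K ⇔-∘ run f (q ++ K))

incᴱ : Eff (inc (level i) ∷ []) σ (σ [ i ]%= suc)
incᴱ {i = i} {σ = σ} = eff λ K →
  resp (sym ∘ store-suc σ i) ⇔-∘ mk⇔ (λ { (inc h) → h }) inc

loop₀ᴱ : lookup σ i ≡ 0 → Eff (loop (level i) p ∷ []) σ σ
loop₀ᴱ {σ = σ} {i} e = eff λ K → mk⇔
  (λ { (loop₀ _ h) → h
     ; (loop₊ {τ = τ} b _) → contradiction σi≡0 (bump-≢0 (level i) {τ = τ} b) })
  (loop₀ σi≡0)
  where
  σi≡0 : store σ (level i) ≡ 0
  σi≡0 = trans (store-level σ i) e

suc-updated : (σ : Vec ℕ k) (i : Fin k) → lookup σ i ≡ suc x → (σ [ i ]≔ x) [ i ]%= suc ≡ σ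
suc-updated (_ ∷ σ) zero    refl = refl
suc-updated (y ∷ σ) (suc i) e    = cong (y ∷_) (suc-updated σ i e)

-- A given run may name any decremented store `τ`; `bump-injective` identifies it with that of
-- `σ [ i ]≔ x`, which yields the direction from the loop to its body.
loop₊ᴱ : lookup σ i ≡ suc x → Eff p (σ [ i ]≔ x) σ′ →
         Eff (loop (level i) p ∷ []) σ′ σ″ → Eff (loop (level i) p ∷ []) σ σ″
loop₊ᴱ {σ = σ} {i} {x} {p} e f g = eff λ K → run g K ⇔-∘ (run f (loop (level i) p ∷ K) ⇔-∘ mk⇔
  (λ { (loop₀ z _) → contradiction (trans (sym (trans (store-level σ i) e)) z) λ ()
     ; (loop₊ {τ = τ} b h) →
         Halts-resp (bump-injective (level i) {τ} (λ j → trans (sym (b j)) (bumped j))) h })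
  (loop₊ bumped))
  where
  bumped : store σ ≗ bump (level i) (store (σ [ i ]≔ x))
  bumped j = trans (cong (λ τ → store τ j) (sym (suc-updated σ i e))) (store-suc (σ [ i ]≔ x) i j)

-- A register holding zero is invisible in the store, so it can be allocated and released without
-- any instruction.
newᴱ : Eff p (0 ∷ σ) (0 ∷ σ′) → Eff p σ σ′
newᴱ {σ = σ} {σ′} f = eff λ K →
  resp (store-alloc σ′) ⇔-∘ (run f K ⇔-∘ resp (sym ∘ store-alloc σ))

-- Clearing, moving and copying registers

clear : Fin k → Code
clear i = loop (level i) [] ∷ []

clearᴱ : (σ : Vec ℕ k) (i : Fin k) → Eff (clear i) σ (σ [ i ]≔ 0)
clearᴱ σ i = go (lookup σ i) σ refl
  where
  go : ∀ x σ → lookup σ i ≡ x → Eff (clear i) σ (σ [ i ]≔ 0)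
  go zero σ e =
    castᴱ (trans (sym (Vecₚ.[]≔-lookup σ i)) (cong (σ [ i ]≔_) e)) (loop₀ᴱ e)
  go (suc x) σ e = loop₊ᴱ e skipᴱ
    (castᴱ (Vecₚ.[]≔-idempotent σ i)
      (go x (σ [ i ]≔ x) (Vecₚ.lookup∘updateAt i σ)))

add : Fin k → ℕ → Vec ℕ k → Vec ℕ k
add i a σ = σ [ i ]%= (a +_)

add-add : ∀ (i : Fin k) a b σ → add i a (add i b σ) ≡ add i (a + b) σ
add-add i a b σ =
  trans (Vecₚ.updateAt-updateAt i σ) (Vecₚ.updateAt-cong i (λ x → sym (+-assoc a b x)) σ)

add-comm : ∀ (i j : Fin k) a b σ → add i a (add j b σ) ≡ add j b (add i a σ)
add-comm zero    zero    a b (x ∷ σ) = cong (_∷ σ)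
  (trans (sym (+-assoc a b x)) (trans (cong (_+ x) (+-comm a b)) (+-assoc b a x)))
add-comm zero    (suc j) a b (x ∷ σ) = refl
add-comm (suc i) zero    a b (x ∷ σ) = refl
add-comm (suc i) (suc j) a b (x ∷ σ) = cong (x ∷_) (add-comm i j a b σ)

add-restore : (σ : Vec ℕ k) (i : Fin k) → add i (lookup σ i) (σ [ i ]≔ 0) ≡ σ
add-restore (x ∷ σ) zero    = cong (_∷ σ) (+-identityʳ x)
add-restore (x ∷ σ) (suc i) = cong (x ∷_) (add-restore σ i)

add-0 : ∀ (i : Fin k) σ → add i 0 σ ≡ σ
add-0 i σ = Vecₚ.updateAt-id i σ

move : Fin k → Code
move {k} i = loop k (inc (level i) ∷ []) ∷ []

moveᴱ : ∀ x (i : Fin k) σ → Eff (move i) (x ∷ σ) (0 ∷ add i x σ)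
moveᴱ zero    i σ = castᴱ (cong (0 ∷_) (sym (add-0 i σ))) (loop₀ᴱ {i = zero} refl)
moveᴱ (suc x) i σ = loop₊ᴱ {i = zero} refl (incᴱ {i = suc i})
  (castᴱ (cong (0 ∷_) (trans (add-add i x 1 σ) (cong (λ a → add i a σ) (+-comm x 1))))
    (moveᴱ x i (add i 1 σ)))

fetchᴱ : ∀ x t (i : Fin k) σ → lookup σ i ≡ x →
         Eff (loop (level i) (inc k ∷ []) ∷ []) (t ∷ σ) (x + t ∷ σ [ i ]≔ 0)
fetchᴱ zero    t i σ e = castᴱ
  (cong (t ∷_) (trans (sym (Vecₚ.[]≔-lookup σ i)) (cong (σ [ i ]≔_) e))) (loop₀ᴱ {i = suc i} e)
fetchᴱ {k} (suc x) t i σ e = loop₊ᴱ {i = suc i} e (incᴱ {i = zero})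
  (castᴱ (cong₂ _∷_ (+-suc x t) (Vecₚ.[]≔-idempotent σ i))
    (fetchᴱ x (suc t) i (σ [ i ]≔ x) (Vecₚ.lookup∘updateAt i σ)))

spreadᴱ : ∀ x (i o : Fin k) σ →
          Eff (loop k (inc (level i) ∷ inc (level o) ∷ []) ∷ []) (x ∷ σ) (0 ∷ add o x (add i x σ))
spreadᴱ zero i o σ = castᴱ
  (cong (0 ∷_) (sym (trans (add-0 o _) (add-0 i σ)))) (loop₀ᴱ {i = zero} refl)
spreadᴱ (suc x) i o σ = loop₊ᴱ {i = zero} refl (incᴱ {i = suc i} ⨟ incᴱ {i = suc o})
  (castᴱ (cong (0 ∷_) eq) (spreadᴱ x i o (add o 1 (add i 1 σ))))
  where
  eq : add o x (add i x (add o 1 (add i 1 σ))) ≡ add o (suc x) (add i (suc x) σ)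
  eq = trans (cong (add o x) (add-comm i o x 1 (add i 1 σ)))
    (trans (add-add o x 1 _) (cong₂ (λ a τ → add o a τ) (+-comm x 1)
      (trans (add-add i x 1 σ) (cong (λ a → add i a σ) (+-comm x 1)))))

-- Level k is scratch; i is emptied and then restored, so i and o may coincide.
copy : Fin k → Fin k → Code
copy {k} i o = loop (level i) (inc k ∷ []) ∷ loop k (inc (level i) ∷ inc (level o) ∷ []) ∷ []

copyᴱ : ∀ (i o : Fin k) σ → Eff (copy i o) σ (add o (lookup σ i) σ)
copyᴱ i o σ = newᴱ
  (castᴱ (cong (_∷ σ [ i ]≔ 0) (+-identityʳ _)) (fetchᴱ (lookup σ i) 0 i σ refl) ⨟
   castᴱ (cong (λ τ → 0 ∷ add o (lookup σ i) τ) (add-restore σ i))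
     (spreadᴱ (lookup σ i) i o (σ [ i ]≔ 0)))

-- p may use the levels k, …, k + m - 1, assumed to be zero at the beginning.
scoped : (m k : ℕ) → Code → Code
scoped zero    k p = p
scoped (suc m) k p = scoped m k (p ++ clear {suc (m + k)} zero)

-- The values `ys` are what `p` leaves in its scratch registers; each is cleared so that `newᴱ` can
-- release it.
scopedᴱ : ∀ m {σ σ′ : Vec ℕ k} (ys : Vec ℕ m) →
          Eff p (Vec.replicate m 0 ++ᵛ σ) (ys ++ᵛ σ′) → Eff (scoped m k p) σ σ′
scopedᴱ zero    []       f = f
scopedᴱ (suc m) {σ′ = σ′} (y ∷ ys) f =
  scopedᴱ m ys (newᴱ (f ⨟ clearᴱ (y ∷ ys ++ᵛ σ′) zero))

-- compile f ρ o adds the value of f at the registers ρ to the register o.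
mutual
  compile : Rec n → Vec (Fin k) n → Fin k → Code
  compile zeroᶠ    ρ       o = []
  compile sucᶠ     (r ∷ _) o = copy r o ++ inc (level o) ∷ []
  compile (proj i) ρ       o = copy (lookup ρ i) o
  compile {k = k} (comp {m} f gs) ρ o = scoped m k
    (compileAll gs (mapᵛ (m ↑ʳ_) ρ) (mapᵛ (_↑ˡ k) (Vec.allFin m)) ++
     compile f (mapᵛ (_↑ˡ k) (Vec.allFin m)) (m ↑ʳ o))
  compile {k = k} (prec f g) (r ∷ ρ) o = scoped 3 k
    (copy (3 ↑ʳ r) (# 2) ++
     (compile f (mapᵛ (3 ↑ʳ_) ρ) (# 0) ++ precLoop g ρ) ++ move {2 + k} (2 ↑ʳ o))
  compile {k = k} (μ f) ρ o = scoped 2 k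
    (compile f (# 1 ∷ mapᵛ (2 ↑ʳ_) ρ) (# 0) ++ μLoop f ρ ++ copy {2 + k} (# 1) (2 ↑ʳ o))

  compileAll : Vec (Rec n) m → Vec (Fin k) n → Vec (Fin k) m → Code
  compileAll []       ρ []       = []
  compileAll (g ∷ gs) ρ (o ∷ os) = compile g ρ o ++ compileAll gs ρ os

  -- Registers: accumulator, index, number of iterations left.
  precLoop : Rec (2 + n) → Vec (Fin k) n → Code
  precLoop {k = k} g ρ = loop (level {3 + k} (# 2)) (precStep g ρ) ∷ []

  precStep : Rec (2 + n) → Vec (Fin k) n → Code
  precStep {k = k} g ρ = scoped 1 (3 + k)
    -- The scratch register `# 0` shifts the accumulator to `# 1` and the index to `# 2`; `g` takes
    -- the index first.
    (compile g (# 2 ∷ # 1 ∷ mapᵛ (4 ↑ʳ_) ρ) (# 0) ++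
     clear {4 + k} (# 1) ++ move {3 + k} (# 0) ++ inc (level {4 + k} (# 2)) ∷ [])

  -- Registers: value, candidate.
  μLoop : Rec (1 + n) → Vec (Fin k) n → Code
  μLoop {k = k} f ρ = loop (level {2 + k} (# 0)) (μStep f ρ) ∷ []

  μStep : Rec (1 + n) → Vec (Fin k) n → Code
  μStep {k = k} f ρ =
    clear {2 + k} (# 0) ++ (inc (level {2 + k} (# 1)) ∷ []) ++
    compile f (# 1 ∷ mapᵛ (2 ↑ʳ_) ρ) (# 0)

-- Correctness of the compiler

lookup-shift : ∀ (ys : Vec ℕ m) (ρ : Vec (Fin k) n) {xs} → mapᵛ (lookup σ) ρ ≡ xs →
               mapᵛ (lookup (ys ++ᵛ σ)) (mapᵛ (m ↑ʳ_) ρ) ≡ xs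
lookup-shift {σ = σ} ys ρ e =
  trans (sym (Vecₚ.map-∘ _ _ ρ)) (trans (Vecₚ.map-cong (Vecₚ.lookup-++ʳ ys σ) ρ) e)

lookup-local : (ys : Vec ℕ m) (σ : Vec ℕ k) →
               mapᵛ (lookup (ys ++ᵛ σ)) (mapᵛ (_↑ˡ k) (Vec.allFin m)) ≡ ys
lookup-local ys σ = trans (sym (Vecₚ.map-∘ _ _ (Vec.allFin _)))
  (trans (Vecₚ.map-cong (Vecₚ.lookup-++ˡ ys σ) (Vec.allFin _)) (Vecₚ.map-lookup-allFin ys))

add-shift : ∀ (ys : Vec ℕ m) (o : Fin k) a σ → add (m ↑ʳ o) a (ys ++ᵛ σ) ≡ ys ++ᵛ add o a σ
add-shift []       o a σ = refl
add-shift (y ∷ ys) o a σ = cong (y ∷_) (add-shift ys o a σ)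

add-local : ∀ (vs : Vec ℕ m) (i : Fin m) a (σ : Vec ℕ k) →
            add (i ↑ˡ k) a (vs ++ᵛ σ) ≡ add i a vs ++ᵛ σ
add-local (v ∷ vs) zero    a σ = refl
add-local (v ∷ vs) (suc i) a σ = cong (v ∷_) (add-local vs i a σ)

adds : Vec (Fin k) n → Vec ℕ n → Vec ℕ k → Vec ℕ k
adds []       []       σ = σ
adds (i ∷ is) (y ∷ ys) σ = adds is ys (add i y σ)

adds-suc : ∀ (is : Vec (Fin k) n) ys v σ → adds (mapᵛ suc is) ys (v ∷ σ) ≡ v ∷ adds is ys σ
adds-suc []       []       v σ = refl
adds-suc (i ∷ is) (y ∷ ys) v σ = adds-suc is ys v (add i y σ)

adds-allFin : (ys : Vec ℕ m) → adds (Vec.allFin m) ys (Vec.replicate m 0) ≡ ys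
adds-allFin []       = refl
adds-allFin {suc m} (y ∷ ys) =
  trans (cong (λ is → adds is (y ∷ ys) (Vec.replicate (suc m) 0)) (Vecₚ.allFin-map m))
    (trans (adds-suc (Vec.allFin m) ys (y + 0) (Vec.replicate m 0))
      (cong₂ _∷_ (+-identityʳ y) (adds-allFin ys)))

mutual
  compileᴱ : ∀ (f : Rec n) (ρ : Vec (Fin k) n) (o : Fin k) σ {xs y} →
             mapᵛ (lookup σ) ρ ≡ xs → f [ xs ]⇓ y → Eff (compile f ρ o) σ (add o y σ)
  compileᴱ zeroᶠ ρ o σ e ⇓zero = castᴱ (sym (add-0 o σ)) skipᴱ
  compileᴱ sucᶠ (r ∷ []) o σ refl ⇓suc =
    copyᴱ r o σ ⨟ castᴱ (add-add o 1 (lookup σ r) σ) incᴱ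
  compileᴱ (proj i) ρ o σ refl ⇓proj =
    castᴱ (cong (λ a → add o a σ) (sym (Vecₚ.lookup-map i (lookup σ) ρ))) (copyᴱ (lookup ρ i) o σ)
  compileᴱ (comp {m} f gs) ρ o σ {y = y} e (⇓comp {ys = ys} hs h) = scopedᴱ m ys
    (castᴱ (cong (_++ᵛ σ) (adds-allFin ys))
       (compileAllᴱ gs ρ (Vec.allFin m) (Vec.replicate m 0) σ e hs) ⨟
     castᴱ (add-shift ys o y σ)
       (compileᴱ f _ (m ↑ʳ o) (ys ++ᵛ σ) (lookup-local ys σ) h))
  compileᴱ (prec f g) (r ∷ ρ) o σ {x ∷ _} {y} refl h = scopedᴱ 3 (0 ∷ x ∷ 0 ∷ [])
    (copyᴱ (3 ↑ʳ r) (# 2) (0 ∷ 0 ∷ 0 ∷ σ) ⨟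
     -- With `c = 0` the counter `x + c` is what `copy` leaves, and the loop stops once it is
     -- exhausted.
     precᴱ f g ρ σ refl h 0 (loop₀ᴱ {i = # 2} refl) ⨟
     moveᴱ y (2 ↑ʳ o) (x ∷ 0 ∷ σ))
  compileᴱ (μ f) ρ o σ {y = y} e (⇓μ below h) with searchᴱ f ρ σ e below h y (+-identityʳ y)
  ... | v , hv , ev = scopedᴱ 2 (0 ∷ y ∷ [])
    (candidateᴱ f ρ σ e hv ⨟ ev ⨟ copyᴱ (# 1) (2 ↑ʳ o) (0 ∷ y ∷ σ))

  candidateᴱ : ∀ (f : Rec (1 + n)) (ρ : Vec (Fin k) n) σ {xs i v} →
               mapᵛ (lookup σ) ρ ≡ xs → f [ i ∷ xs ]⇓ v →
               Eff (compile f (# 1 ∷ mapᵛ (2 ↑ʳ_) ρ) (# 0)) (0 ∷ i ∷ σ) (v ∷ i ∷ σ)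
  candidateᴱ f ρ σ {i = i} {v} e h = castᴱ (cong (_∷ i ∷ σ) (+-identityʳ v))
    (compileᴱ f _ (# 0) (0 ∷ i ∷ σ) (cong (i ∷_) (lookup-shift (0 ∷ i ∷ []) ρ e)) h)

  -- Induction on the distance `d` from the candidate `i` to `y`. The value `v` at `i` is returned
  -- as well, because the preceding iteration must leave it in the loop register.
  searchᴱ : ∀ (f : Rec (1 + n)) (ρ : Vec (Fin k) n) σ {xs y} → mapᵛ (lookup σ) ρ ≡ xs →
            (∀ i → i < y → ∃ λ u → f [ i ∷ xs ]⇓ suc u) → f [ y ∷ xs ]⇓ 0 → ∀ d {i} → d + i ≡ y →
            ∃ λ v → f [ i ∷ xs ]⇓ v × Eff (μLoop f ρ) (v ∷ i ∷ σ) (0 ∷ y ∷ σ)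
  searchᴱ f ρ σ e below h zero    refl = 0 , h , loop₀ᴱ {i = # 0} refl
  searchᴱ f ρ σ e below h (suc d) {i} refl
    with searchᴱ f ρ σ e below h d (+-suc d i) | below i (s≤s (m≤n+m i d))
  ... | v , hv , ev | u , hu = suc u , hu , loop₊ᴱ {i = # 0} refl
    (clearᴱ (u ∷ i ∷ σ) (# 0) ⨟ incᴱ {i = # 1} ⨟ candidateᴱ f ρ σ e hv) ev

  -- The last argument accounts for the c iterations still to be made.
  precᴱ : ∀ (f : Rec n) g (ρ : Vec (Fin k) n) σ {xs x y σ′} → mapᵛ (lookup σ) ρ ≡ xs →
          prec f g [ x ∷ xs ]⇓ y → ∀ c → Eff (precLoop g ρ) (y ∷ x ∷ c ∷ σ) σ′ →
          Eff (compile f (mapᵛ (3 ↑ʳ_) ρ) (# 0) ++ precLoop g ρ) (0 ∷ 0 ∷ x + c ∷ σ) σ′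
  precᴱ f g ρ σ {y = y} e (⇓prec-zero h) c rest =
    castᴱ (cong (_∷ 0 ∷ c ∷ σ) (+-identityʳ y))
      (compileᴱ f _ (# 0) (0 ∷ 0 ∷ c ∷ σ) (lookup-shift (0 ∷ 0 ∷ c ∷ []) ρ e) h) ⨟ rest
  precᴱ f g ρ σ {x = suc x} {y} {σ′} e (⇓prec-suc {r = r} d h) c rest =
    subst (λ a → Eff (compile f (mapᵛ (3 ↑ʳ_) ρ) (# 0) ++ precLoop g ρ) (0 ∷ 0 ∷ a ∷ σ) σ′)
      (+-suc x c)
      -- The first of the `suc c` pending iterations turns `r` into `y`; `rest` performs the others.
      (precᴱ f g ρ σ e d (suc c) (loop₊ᴱ {i = # 2} refl (scopedᴱ 1 (0 ∷ [])
        (castᴱ (cong (_∷ r ∷ x ∷ c ∷ σ) (+-identityʳ y))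
          (compileᴱ g _ (# 0) (0 ∷ r ∷ x ∷ c ∷ σ)
            (cong (λ z → x ∷ r ∷ z) (lookup-shift (0 ∷ r ∷ x ∷ c ∷ []) ρ e)) h) ⨟
         clearᴱ (y ∷ r ∷ x ∷ c ∷ σ) (# 1) ⨟
         castᴱ (cong (λ a → 0 ∷ a ∷ x ∷ c ∷ σ) (+-identityʳ y)) (moveᴱ y (# 0) (0 ∷ x ∷ c ∷ σ)) ⨟
         incᴱ {i = # 2})) rest))

  compileAllᴱ : ∀ {l} (gs : Vec (Rec n) m) (ρ : Vec (Fin k) n) (is : Vec (Fin l) m) vs σ {xs ys} →
                mapᵛ (lookup σ) ρ ≡ xs → (∀ i → lookup gs i [ xs ]⇓ lookup ys i) →
                Eff (compileAll gs (mapᵛ (l ↑ʳ_) ρ) (mapᵛ (_↑ˡ k) is))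
                    (vs ++ᵛ σ) (adds is ys vs ++ᵛ σ)
  compileAllᴱ []       ρ []       vs σ {ys = []}     e hs = skipᴱ
  compileAllᴱ {k = k} (g ∷ gs) ρ (i ∷ is) vs σ {ys = y ∷ ys} e hs =
    castᴱ (add-local vs i y σ)
      (compileᴱ g _ (i ↑ˡ k) (vs ++ᵛ σ) (lookup-shift vs ρ e) (hs zero)) ⨟
    compileAllᴱ gs ρ is (add i y vs) σ e (λ j → hs (suc j))

-- Diagonalisation

⇓comp₁ : ∀ {f : Rec 1} {g : Rec n} → g [ xs ]⇓ x → f [ x ∷ [] ]⇓ z → comp f (g ∷ []) [ xs ]⇓ z
⇓comp₁ {x = x} a = ⇓comp {ys = x ∷ []} λ { zero → a }

⇓comp₂ : ∀ {f : Rec 2} {g h : Rec n} → g [ xs ]⇓ x → h [ xs ]⇓ y → f [ x ∷ y ∷ [] ]⇓ z →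
        comp f (g ∷ h ∷ []) [ xs ]⇓ z
⇓comp₂ {x = x} {y = y} a b = ⇓comp {ys = x ∷ y ∷ []} λ { zero → a ; (suc zero) → b }

constᴿ : ℕ → Rec n
constᴿ zero    = comp zeroᶠ []
constᴿ (suc c) = comp sucᶠ (constᴿ c ∷ [])

constᴿ-⇓ : ∀ c → constᴿ c [ xs ]⇓ c
constᴿ-⇓ zero    = ⇓comp {ys = []} (λ ()) ⇓zero
constᴿ-⇓ (suc c) = ⇓comp₁ (constᴿ-⇓ c) ⇓suc

addᴿ : Rec 2
addᴿ = prec (proj (# 0)) (comp sucᶠ (proj (# 1) ∷ []))

addᴿ-⇓ : ∀ x y → addᴿ [ x ∷ y ∷ [] ]⇓ (x + y)
addᴿ-⇓ zero    y = ⇓prec-zero ⇓proj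
addᴿ-⇓ (suc x) y = ⇓prec-suc (addᴿ-⇓ x y) (⇓comp₁ ⇓proj ⇓suc)

triangleᴿ : Rec 1
triangleᴿ = prec zeroᶠ (comp sucᶠ (addᴿ ∷ []))

triangleᴿ-⇓ : ∀ x → triangleᴿ [ x ∷ [] ]⇓ triangle x
triangleᴿ-⇓ zero    = ⇓prec-zero ⇓zero
triangleᴿ-⇓ (suc x) = ⇓prec-suc (triangleᴿ-⇓ x) (⇓comp₁ (addᴿ-⇓ x _) ⇓suc)

pairᴿ : Rec 2
pairᴿ = comp addᴿ (proj (# 0) ∷ comp triangleᴿ (addᴿ ∷ []) ∷ [])

pairᴿ-⇓ : ∀ x y → pairᴿ [ x ∷ y ∷ [] ]⇓ pair x y
pairᴿ-⇓ x y = ⇓comp₂ ⇓proj (⇓comp₁ (addᴿ-⇓ x y) (triangleᴿ-⇓ (x + y))) (addᴿ-⇓ x _)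

consᴿ : ℕ → Rec n → Rec n
consᴿ c f = comp sucᶠ (comp pairᴿ (constᴿ c ∷ f ∷ []) ∷ [])

consᴿ-⇓ : ∀ c {f : Rec n} → f [ xs ]⇓ y → consᴿ c f [ xs ]⇓ suc (pair c y)
consᴿ-⇓ c h = ⇓comp₁ (⇓comp₂ (constᴿ-⇓ c) h (pairᴿ-⇓ c _)) ⇓suc

module Diagonal (Γ₀ : List TreeTerm) (T : TreeTerm) (A : Formula) where

  query : Stoup → ℕ → Sequent
  query ζ m = ζ ⨾ Γ₀ ++ replicate m T ⇒ A

  replicateᴿ : Rec 1
  replicateᴿ = prec zeroᶠ (consᴿ (codeT T) (proj (# 1)))

  replicateᴿ-⇓ : ∀ m → replicateᴿ [ m ∷ [] ]⇓ codeSeq (replicate m T)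
  replicateᴿ-⇓ zero    = ⇓prec-zero ⇓zero
  replicateᴿ-⇓ (suc m) = ⇓prec-suc (replicateᴿ-⇓ m) (consᴿ-⇓ (codeT T) ⇓proj)

  sequenceᴿ : List TreeTerm → Rec 1
  sequenceᴿ []      = replicateᴿ
  sequenceᴿ (U ∷ Γ) = consᴿ (codeT U) (sequenceᴿ Γ)

  sequenceᴿ-⇓ : ∀ Γ m → sequenceᴿ Γ [ m ∷ [] ]⇓ codeSeq (Γ ++ replicate m T)
  sequenceᴿ-⇓ []      m = replicateᴿ-⇓ m
  sequenceᴿ-⇓ (U ∷ Γ) m = consᴿ-⇓ (codeT U) (sequenceᴿ-⇓ Γ m)

  -- The argument serves twice, as the code of the stoup and as the number of copies of `T`, so no
  -- decoding is required.
  diagonalᴿ : Rec 1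
  diagonalᴿ = comp pairᴿ (comp pairᴿ (proj (# 0) ∷ sequenceᴿ Γ₀ ∷ []) ∷ constᴿ (codeF A) ∷ [])

  diagonalᴿ-⇓ : ∀ ζ → diagonalᴿ [ codeStoup ζ ∷ [] ]⇓ codeSequent (query ζ (codeStoup ζ))
  diagonalᴿ-⇓ ζ = ⇓comp₂ (⇓comp₂ ⇓proj (sequenceᴿ-⇓ Γ₀ (codeStoup ζ)) (pairᴿ-⇓ (codeStoup ζ) _))
    (constᴿ-⇓ (codeF A)) (pairᴿ-⇓ _ (codeF A))

-- A machine that halts on output 0 and diverges on output 1

spin : Code
spin = loop 1 (inc 1 ∷ []) ∷ []

spin-diverges : ∀ {σ} → σ 1 ≢ 0 → ¬ Halts spin σ
spin-diverges nz (loop₀ z _)               = nz z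
spin-diverges nz (loop₊ {τ = τ} b (inc h)) = spin-diverges (bump-≢0 1 {τ = τ} (λ _ → refl)) h

input : ∀ m → count (replicate m 0) ≗ store (0 ∷ m ∷ [])
input m j = trans (count-input m j) (sym (store-alloc (m ∷ []) j))
  where
  count-input : ∀ m → count (replicate m 0) ≗ store (m ∷ [])
  count-input zero    j = sym (store-alloc [] j)
  count-input (suc m) j = trans (bump-cong 0 (count-input m) j) (sym (store-suc (m ∷ []) zero j))

-- By the level numbering, `# 1` is register 0, the input, and `# 0` is register 1, the output that
-- `spin` tests. The input is cleared because halting requires an empty store.
prologue : Rec 1 → Code
prologue q = compile {k = 2} q (# 1 ∷ []) (# 0) ++ clear {2} (# 1)

prologueᴱ : ∀ q {m v} → q [ m ∷ [] ]⇓ v → Eff (prologue q) (0 ∷ m ∷ []) (v ∷ 0 ∷ [])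
prologueᴱ q {m} {v} h =
  castᴱ (cong (_∷ m ∷ []) (+-identityʳ v)) (compileᴱ q (# 1 ∷ []) (# 0) (0 ∷ m ∷ []) refl h) ⨟
  clearᴱ (v ∷ m ∷ []) (# 1)

machine : Rec 1 → Code
machine q = prologue q ++ spin

machine-halts : ∀ q {m} → q [ m ∷ [] ]⇓ 0 → Halts (machine q) (count (replicate m 0))
machine-halts q {m} h = Halts-resp (sym ∘ input m)
  (Equivalence.from (run (prologueᴱ q h) spin) (loop₀ refl (done zeros)))
  where
  zeros : ∀ j → store (0 ∷ 0 ∷ []) j ≡ 0
  zeros j = trans (store-alloc (0 ∷ []) j) (store-alloc [] j)

machine-diverges : ∀ q {m} → q [ m ∷ [] ]⇓ 1 → ¬ Halts (machine q) (count (replicate m 0))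
machine-diverges q {m} h halts =
  spin-diverges (λ ()) (Equivalence.to (run (prologueᴱ q h) spin) (Halts-resp (input m) halts))

open Diagonal (fm E ∷ letters (start ∷ marker ∷ [])) (fm (atom (reg 0))) S

letters-replicate : ∀ m → letters (map reg (replicate m 0)) ≡ replicate m (fm (atom (reg 0)))
letters-replicate zero    = refl
letters-replicate (suc m) = cong (_ ∷_) (letters-replicate m)

module _ (q : Rec 1) where

  open Machine (machine q)

  stoup : Stoup
  stoup = program final rules

  query-derivable : ∀ {m} → q [ m ∷ [] ]⇓ 0 → ⊢ query stoup m
  query-derivable {m} h = cast (cong (λ Γ → fm E ∷ _ ∷ _ ∷ Γ) (letters-replicate m))
    (halts⇒derivable-init m (machine-halts q h))

  query-underivable : ∀ {m} → q [ m ∷ [] ]⇓ 1 → ¬ (⊢ query stoup m)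
  query-underivable {m} h d = machine-diverges q h (derivable⇒halts (replicate m 0)
    (cast (cong (λ Γ → fm E ∷ _ ∷ _ ∷ Γ) (sym (letters-replicate m))) d))

theorem9 : ¬ (AlgorithmicallyDecidable gödel ⊢_)
theorem9 (d , decides) = underivable (query-derivable f (answer (proj₂ (decides self) underivable)))
  where
  f    = comp d (diagonalᴿ ∷ [])
  self = query (stoup f) (codeStoup (stoup f))

  answer : d [ codeSequent self ∷ [] ]⇓ y → f [ codeStoup (stoup f) ∷ [] ]⇓ y
  answer = ⇓comp₁ (diagonalᴿ-⇓ (stoup f))

  -- A derivation would make `d` answer 1 and the machine diverge, contradicting that derivation. So
  -- the answer is 0, with no case distinction on derivability.
  underivable : ¬ (⊢ self)
  underivable ⊢self = query-underivable f (answer (proj₁ (decides self) ⊢self)) ⊢self
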